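{- For every integer $k\ge 2$ the following hold as $n\to\infty$ (each $o(n)$ denotes a function $f(n)$ with $f(n)/n\to 0$, depending on $k$): \begin{itemize} \item if $k\in\{2,3,5\}$, then $H(n,2k)\le n^{\left(1-\frac{1}{k^2}\right)n-o(n)}$; \item if $k\notin\{2,3,5\}$ and $k$ is even, then $H(n,2k)\le n^{\left(1-\frac{2}{3k^2-2k}\right)n-o(n)}$; \item if $k\notin\{2,3,5\}$ and $k$ is odd, then $H(n,2k)\le n^{\left(1-\frac{2}{3k^2-3k}\right)n-o(n)}$. \end{itemize}
   Context: Two graphs $H_1,H_2$ on the same vertex set are called $G$-creating if their union $H_1\cup H_2$ (the graph on that vertex set whose edge set is the union of their edge sets) contains $G$ as a subgraph. A family of graphs is pairwise $G$-creating if every two distinct members are $G$-creating. $C_\ell$ denotes the cycle of length $\ell$. $H(n,\ell)$ denotes the maximum number of pairwise $C_\ell$-creating paths (of arbitrary length) on the vertex set $[n]=\{1,\dots,n\}$; equivalently, the maximum number of pairwise $C_\ell$-creating Hamiltonian paths of the complete graph $K_n$. -}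

module Defs where

open import Data.Nat using (ℕ; zero; suc; _+_; _*_; _∸_; _^_; _≤_; _<_; _%_)
open import Data.Fin using (Fin; zero; suc; inject₁; fromℕ)
open import Data.List using (List; []; _∷_; length; lookup)
open import Data.List.Relation.Unary.All using (All)
open import Data.List.Relation.Unary.Unique.Propositional using (Unique)
open import Data.Product using (Σ; _×_; ∃-syntax)
open import Data.Sum using (_⊎_)
open import Data.Empty using (⊥)
open import Function.Definitions using (Injective)
open import Relation.Binary.PropositionalEquality using (_≡_; _≢_)

data Consec {A : Set} : List A → A → A → Set where
  here  : ∀ {x y xs} → Consec (x ∷ y ∷ xs) x y
  there : ∀ {x xs a b} → Consec xs a b → Consec (x ∷ xs) a b

IsPath : ∀ {n} → List (Fin n) → Set
IsPath {n} P = Unique P × (1 ≤ length P)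

PathEdge : ∀ {n} → List (Fin n) → Fin n → Fin n → Set
PathEdge P a b = Consec P a b ⊎ Consec P b a

UnionEdge : ∀ {n} → List (Fin n) → List (Fin n) → Fin n → Fin n → Set
UnionEdge P Q a b = PathEdge P a b ⊎ PathEdge Q a b

ContainsCycle : ∀ {n} → ℕ → (Fin n → Fin n → Set) → Set
ContainsCycle {n} zero    E = ⊥
ContainsCycle {n} (suc m) E =
  Σ (Fin (suc m) → Fin n) λ c →
    Injective _≡_ _≡_ c ×
    ((∀ (i : Fin m) → E (c (inject₁ i)) (c (suc i))) × E (c (fromℕ m)) (c zero))

Creating : ∀ {n} → ℕ → List (Fin n) → List (Fin n) → Set
Creating ℓ P Q = ContainsCycle ℓ (UnionEdge P Q)

-- a family (listed without repetition) of paths on [n] which is pairwise C_ℓ-creating.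
-- (Two entries of the list at distinct positions must be C_ℓ-creating; since a
--  single path contains no cycle, this also forces the listed graphs to be distinct.)
PairwiseCreating : (n ℓ : ℕ) → List (List (Fin n)) → Set
PairwiseCreating n ℓ F =
  All IsPath F ×
  (∀ (i j : Fin (length F)) → i ≢ j → Creating ℓ (lookup F i) (lookup F j))

-- "H(n, ℓ) ≤ n^{(a/b) n + o(n)}" as n → ∞, stated without reals:
-- for every rational p/q > a/b, for all large n, every pairwise C_ℓ-creating family F
-- of paths on [n] satisfies |F| ≤ n^{(p/q) n}, i.e. |F|^q ≤ n^{p n}.
UpperRate : (ℓ a b : ℕ) → Set
UpperRate ℓ a b =
  ∀ (p q : ℕ) → 0 < q → q * a < p * b →
    ∃[ N ] ∀ (n : ℕ) → N ≤ n →
      ∀ (F : List (List (Fin n))) → PairwiseCreating n ℓ F →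
        length F ^ q ≤ n ^ (p * n)

{-# OPTIONS --safe #-}

-- All three rates are at least 1 - 1/(2k), and this weaker bound already holds for
-- every k.  Let G be a graph on N = O(n) vertices without C_ℓ, ℓ = 2k, and let f, f'
-- be Hamiltonian paths on [n] and g, g' paths on n vertices of G, all viewed as
-- sequences.  If g ∘ f⁻¹ = g' ∘ f'⁻¹, then this injection maps the union of f and f'
-- into G, so f and f' are not C_ℓ-creating.  Hence for a creating family F the map
-- (f , g) ↦ g ∘ f⁻¹ is injective, and |F| · #{g} ≤ N ^ n.
--
-- G is built greedily: layers of O(n) vertices, every vertex with q ≈ n ^ (1/ℓ)
-- out-neighbours in the next layer, in-degrees O(q), and no edge ever closing a C_ℓ.
-- Choosing walks through the T + 1 layers one after the other, so that each avoids the
-- previous ones, gives at least (q ^ T) ^ m tuples of m disjoint walks.  A path is cut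
-- into segments of T edges to be mapped along such walks, separated by windows of ℓ
-- edges whose vertices are recorded in the code instead; no C_ℓ in the union can pass
-- through a window that two paths share.  Taking T large makes the windows negligible.
module Submission where

open import Defs
open import Data.Nat
  using (ℕ; zero; suc; pred; _+_; _*_; _^_; _∸_; _≤_; _<_; _<?_; _≤?_; z≤n; s≤s; _/_; _%_; NonZero; >-nonZero)
open import Data.Nat.Properties hiding (_≟_)
import Data.Nat.Properties as ℕ
open import Data.Nat.DivMod
  using (m≡m%n+[m/n]*n; m%n<n; [m+kn]%n≡m%n; m<n⇒m%n≡m; m<n⇒m/n≡0; m*n/n≡m; +-distrib-/-∣ʳ; n%n≡0;
         m<n*o⇒m/o<n; /-monoˡ-≤; m/n*n≤m; _mod_)
open import Data.Nat.Divisibility using (divides-refl)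
open import Data.Nat.Tactic.RingSolver using (solve-∀)
open import Data.Fin as Fin using (Fin; toℕ; fromℕ<; inject≤; combine; remQuot; funToFin)
import Data.Fin.Properties as Fin
open import Data.List
  using (List; []; _∷_; [_]; head; tail; length; lookup; map; concatMap; filter; replicate; _++_; _ʳ++_; upTo; allFin)
open import Data.List.Properties
  using (length-map; length-++; length-upTo; length-tabulate; length-replicate; filter-++; filter-all; filter-none)
open import Data.List.Membership.Propositional using (_∈_; _∉_; find; lose)
open import Data.List.Membership.Propositional.Properties
  using (∈-map⁺; ∈-map⁻; ∈-filter⁺; ∈-filter⁻; ∈-concatMap⁺; ∈-concatMap⁻; ∈-++⁺ˡ; ∈-++⁺ʳ; ∈-upTo⁺; ∈-upTo⁻;
         ∈-allFin; ∈-lookup)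
open import Data.List.Membership.Setoid.Properties using (index-injective)
open import Data.List.Relation.Unary.Any as Any using (here; there)
open import Data.List.Relation.Unary.All as All using (All; []; _∷_; all?)
open import Data.List.Relation.Unary.All.Properties using (¬Any⇒All¬; ¬All⇒Any¬; replicate⁺)
open import Data.List.Relation.Unary.AllPairs using (AllPairs; []; _∷_)
open import Data.List.Relation.Unary.Unique.Propositional using (Unique)
import Data.List.Relation.Unary.Unique.Propositional.Properties as Unique
open import Data.List.Relation.Binary.Disjoint.Propositional using (Disjoint)
open import Data.Maybe as Maybe using (Maybe; just; nothing; _>>=_)
open import Data.Maybe.Properties using (just-injective)
open import Data.Product using (_×_; _,_; proj₁; proj₂; ∃-syntax; ∃₂)
open import Data.Product.Properties using (≡-dec)
open import Data.Sum using (_⊎_; inj₁; inj₂; swap)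
open import Data.Empty using (⊥; ⊥-elim)
open import Relation.Nullary using (¬_; yes; no; contradiction; ¬?; _×-dec_)
open import Relation.Nullary.Decidable using (decidable-stable)
open import Relation.Unary using (Decidable)
open import Relation.Binary.Definitions using (DecidableEquality)
open import Relation.Binary.PropositionalEquality hiding ([_])
open import Function using (_∘_; case_of_; id)

-- Lists: partial indexing and counting by injections

private variable
  A B : Set

-- Positions are plain numbers and may run past the end, so that block arithmetic and the agreement
-- of two lists at a position need no bounds.
at : List A → ℕ → Maybe A
at []       _       = nothing
at (x ∷ _)  zero    = just x
at (_ ∷ xs) (suc i) = at xs i

at-∈ : ∀ {x : A} xs i → at xs i ≡ just x → x ∈ xs
at-∈ (x ∷ xs) zero    refl = here refl
at-∈ (x ∷ xs) (suc i) eq   = there (at-∈ xs i eq)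

at-< : ∀ {x : A} xs i → at xs i ≡ just x → i < length xs
at-< (x ∷ xs) zero    eq = s≤s z≤n
at-< (x ∷ xs) (suc i) eq = s≤s (at-< xs i eq)

<-at : ∀ (xs : List A) i → i < length xs → ∃[ x ] at xs i ≡ just x
<-at (x ∷ xs) zero    _       = x , refl
<-at (x ∷ xs) (suc i) (s≤s p) = <-at xs i p

at-injective : ∀ {x : A} {xs} → Unique xs → ∀ i j → at xs i ≡ just x → at xs j ≡ just x → i ≡ j
at-injective (x∉ ∷ u) zero    zero    p    q    = refl
at-injective (x∉ ∷ u) zero    (suc j) refl q    = contradiction refl (All.lookup x∉ (at-∈ _ j q))
at-injective (x∉ ∷ u) (suc i) zero    p    refl = contradiction refl (All.lookup x∉ (at-∈ _ i p))
at-injective (x∉ ∷ u) (suc i) (suc j) p    q    = cong suc (at-injective u i j p q)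

at-lookup : ∀ (xs : List A) i → at xs (toℕ i) ≡ just (lookup xs i)
at-lookup (x ∷ xs) Fin.zero    = refl
at-lookup (x ∷ xs) (Fin.suc i) = at-lookup xs i

lookup-injective : ∀ {xs : List A} → Unique xs → ∀ i j → lookup xs i ≡ lookup xs j → i ≡ j
lookup-injective {xs = xs} u i j eq = Fin.toℕ-injective
  (at-injective u (toℕ i) (toℕ j) (at-lookup xs i) (trans (at-lookup xs j) (cong just (sym eq))))

at-ext : ∀ (xs ys : List A) → length xs ≡ length ys →
         (∀ i x → at xs i ≡ just x → at ys i ≡ just x) → xs ≡ ys
at-ext []       []       _  _ = refl
at-ext (x ∷ xs) (y ∷ ys) eq h with h 0 x refl
... | refl = cong (x ∷_) (at-ext xs ys (suc-injective eq) (λ i → h (suc i)))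

-- Sending a position in `xs` to the position of its entry in `ys` is injective.
length-⊆ : ∀ {xs ys : List A} → Unique xs → (∀ {x} → x ∈ xs → x ∈ ys) → length xs ≤ length ys
length-⊆ {xs = xs} u sub = Fin.injective⇒≤ {f = λ i → Any.index (sub (∈-lookup i))} λ {i} {j} eq →
  lookup-injective u i j (index-injective (setoid _) (sub (∈-lookup i)) (sub (∈-lookup j)) eq)

length-concatMap-≥ : ∀ c (f : A → List B) xs → (∀ {x} → x ∈ xs → c ≤ length (f x)) →
                     length xs * c ≤ length (concatMap f xs)
length-concatMap-≥ c f []       h = z≤n
length-concatMap-≥ c f (x ∷ xs) h rewrite length-++ (f x) {concatMap f xs} =
  +-mono-≤ (h (here refl)) (length-concatMap-≥ c f xs (h ∘ there))

length-concatMap-≤ : ∀ c (f : A → List B) xs → (∀ {x} → x ∈ xs → length (f x) ≤ c) →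
                     length (concatMap f xs) ≤ length xs * c
length-concatMap-≤ c f []       h = z≤n
length-concatMap-≤ c f (x ∷ xs) h rewrite length-++ (f x) {concatMap f xs} =
  +-mono-≤ (h (here refl)) (length-concatMap-≤ c f xs (h ∘ there))

∈-concatMap⁻′ : ∀ (f : A → List B) {y} xs → y ∈ concatMap f xs → ∃[ x ] x ∈ xs × y ∈ f x
∈-concatMap⁻′ f xs y∈ = find (∈-concatMap⁻ f {xs = xs} y∈)

-- key y records from which x the element y of f x came, so that the
-- blocks f x are disjoint.
Unique-concatMap : ∀ (f : A → List B) (key : B → Maybe A) {xs} → Unique xs →
                   (∀ x → Unique (f x)) → (∀ x {y} → y ∈ f x → key y ≡ just x) →
                   Unique (concatMap f xs)
Unique-concatMap f key []              uf k = []
Unique-concatMap f key {x ∷ xs} (x∉ ∷ u) uf k =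
  Unique.++⁺ (uf x) (Unique-concatMap f key u uf k) λ (y∈ , y∈′) →
    let x′ , x′∈ , q = ∈-concatMap⁻′ f xs y∈′
    in contradiction (just-injective (trans (sym (k x y∈)) (k x′ q))) (All.lookup x∉ x′∈)

length-filter-¬ : ∀ {P : A → Set} (P? : Decidable P) (xs : List A) →
                  length xs ≡ length (filter P? xs) + length (filter (¬? ∘ P?) xs)
length-filter-¬ P? [] = refl
length-filter-¬ P? (x ∷ xs) with P? x
... | yes _ = cong suc (length-filter-¬ P? xs)
... | no  _ = trans (cong suc (length-filter-¬ P? xs)) (sym (+-suc _ _))

-- Greedy construction of digraphs without a cycle of given length

-- The cycle is unrolled into a sequence of period `ℓ`: the closing edge is then no special case,
-- and any index can serve as the starting point.
record Cycle {V : Set} (ℓ : ℕ) (_~_ : V → V → Set) : Set where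
  field
    c         : ℕ → V
    adjacent  : ∀ i → c i ~ c (suc i)
    injective : ∀ {i j} → i < j → j < i + ℓ → c i ≢ c j
    periodic  : ∀ i → c (i + ℓ) ≡ c i

data Chain {V : Set} (next : V → List V) : V → List V → Set where
  []  : ∀ {u} → Chain next u []
  _∷_ : ∀ {u v vs} → v ∈ next u → Chain next v vs → Chain next u (v ∷ vs)

chains : {V : Set} → (V → List V) → ℕ → V → List (List V)
chains next zero    u = [ [] ]
chains next (suc s) u = concatMap (λ v → map (v ∷_) (chains next s v)) (next u)

module _ {V : Set} {next : V → List V} where

  ∈-chains⁺ : ∀ {u vs} → Chain next u vs → vs ∈ chains next (length vs) u
  ∈-chains⁺ []       = here refl
  ∈-chains⁺ (v∈ ∷ p) = ∈-concatMap⁺ _ (lose v∈ (∈-map⁺ _ (∈-chains⁺ p)))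

  ∈-chains⁻ : ∀ s {u vs} → vs ∈ chains next s u → Chain next u vs × length vs ≡ s
  ∈-chains⁻ zero    (here refl) = [] , refl
  ∈-chains⁻ (suc s) {u} vs∈ with ∈-concatMap⁻′ _ (next u) vs∈
  ... | v , v∈ , p with ∈-map⁻ _ p
  ... | ws , ws∈ , refl = let ch , eq = ∈-chains⁻ s ws∈ in v∈ ∷ ch , cong suc eq

  length-chains-≤ : ∀ {d} → (∀ u → length (next u) ≤ d) → ∀ s u → length (chains next s u) ≤ d ^ s
  length-chains-≤ h zero    u = ≤-refl
  length-chains-≤ {d} h (suc s) u = ≤-trans
    (length-concatMap-≤ (d ^ s) _ (next u)
      (λ {v} _ → ≤-trans (≤-reflexive (length-map _ (chains next s v))) (length-chains-≤ h s v)))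
    (*-monoˡ-≤ (d ^ s) (h u))

  Unique-chains : (∀ u → Unique (next u)) → ∀ s u → Unique (chains next s u)
  Unique-chains h zero    u = [] ∷ []
  Unique-chains h (suc s) u = Unique-concatMap _ head (h u)
    (λ v → Unique.map⁺ (λ { refl → refl }) (Unique-chains h s v))
    λ v y∈ → case ∈-map⁻ _ y∈ of λ { (_ , _ , refl) → refl }

module Digraph {V : Set} (_≟_ : DecidableEquality V) where

  open import Data.List.Membership.DecPropositional _≟_ using (_∈?_)

  private variable
    E : List (V × V)
    u v : V

  outs ins nbrs : List (V × V) → V → List V
  outs E u = map proj₂ (filter (λ e → proj₁ e ≟ u) E)
  ins  E v = map proj₁ (filter (λ e → proj₂ e ≟ v) E)
  nbrs E u = outs E u ++ ins E u

  Adj : List (V × V) → V → V → Set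
  Adj E u v = (u , v) ∈ E ⊎ (v , u) ∈ E

  ∈-outs⁺ : (u , v) ∈ E → v ∈ outs E u
  ∈-outs⁺ {u} e∈ = ∈-map⁺ proj₂ (∈-filter⁺ (λ e → proj₁ e ≟ u) e∈ refl)

  ∈-ins⁺ : (u , v) ∈ E → u ∈ ins E v
  ∈-ins⁺ {v = v} e∈ = ∈-map⁺ proj₁ (∈-filter⁺ (λ e → proj₂ e ≟ v) e∈ refl)

  ∈-outs⁻ : v ∈ outs E u → (u , v) ∈ E
  ∈-outs⁻ {u = u} v∈ with ∈-map⁻ proj₂ v∈
  ... | e , e∈ , refl with ∈-filter⁻ (λ e → proj₁ e ≟ u) e∈
  ... | e∈E , refl = e∈E

  ∈-nbrs⁺ : Adj E u v → v ∈ nbrs E u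
  ∈-nbrs⁺         (inj₁ e∈) = ∈-++⁺ˡ (∈-outs⁺ e∈)
  ∈-nbrs⁺ {E} {u} (inj₂ e∈) = ∈-++⁺ʳ (outs E u) (∈-ins⁺ e∈)

  Unique-outs : Unique E → ∀ u → Unique (outs E u)
  Unique-outs {E} uE u = go (Unique.filter⁺ (λ e → proj₁ e ≟ u) uE)
    (λ e∈ → proj₂ (∈-filter⁻ (λ e → proj₁ e ≟ u) {xs = E} e∈))
    where
    go : ∀ {xs} → Unique xs → (∀ {e} → e ∈ xs → proj₁ e ≡ u) → Unique (map proj₂ xs)
    go []       h = []
    go {xs = (a , b) ∷ xs} (x∉ ∷ p) h = All.tabulate (λ y∈ b≡y → case ∈-map⁻ proj₂ y∈ of λ where
        ((a′ , b′) , e∈ , refl) → All.lookup x∉ e∈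
          (cong₂ _,_ (trans (h (here refl)) (sym (h (there e∈)))) b≡y))
      ∷ go p (h ∘ there)

  -- Orientation is ignored and endpoints are listed with repetition: it matters only that no end of
  -- a path with `s` edges is missing and that the list is short.
  reach : List (V × V) → ℕ → V → List V
  reach E zero    u = [ u ]
  reach E (suc s) u = concatMap (nbrs E) (reach E s u)

  length-reach : ∀ {d} → (∀ u → length (nbrs E u) ≤ d) → ∀ s u → length (reach E s u) ≤ d ^ s
  length-reach h zero u = ≤-refl
  length-reach {E} {d} h (suc s) u = ≤-trans (length-concatMap-≤ d _ (reach E s u) (λ _ → h _))
    (≤-trans (*-monoˡ-≤ d (length-reach {E} h s u)) (≤-reflexive (*-comm (d ^ s) d)))

  walk-reach : ∀ s (w : ℕ → V) → (∀ k → k < s → Adj E (w k) (w (suc k))) → w s ∈ reach E s (w 0)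
  walk-reach zero    w h = here refl
  walk-reach (suc s) w h = ∈-concatMap⁺ _ (lose (walk-reach s w (λ k k<s → h k (m<n⇒m<1+n k<s)))
    (∈-nbrs⁺ (h s ≤-refl)))

  walk-reach-reverse : ∀ s (w : ℕ → V) → (∀ k → k < s → Adj E (w k) (w (suc k))) → w 0 ∈ reach E s (w s)
  walk-reach-reverse {E} s w h = subst (λ i → w i ∈ reach E s (w s)) (n∸n≡0 s)
    (walk-reach s (λ k → w (s ∸ k)) λ k k<s →
      subst (λ i → Adj E (w i) (w (s ∸ suc k))) (sym (+-∸-assoc 1 k<s))
        (swap (h (s ∸ suc k) (∸-monoʳ-< (s≤s z≤n) k<s))))

  -- A cycle of length `suc s` through the new edge would leave, once that edge is removed, a walk
  -- of `s` old edges between `u` and `v`.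
  extend-acyclic : ∀ s → 2 ≤ s → v ∉ reach E s u →
                   ¬ Cycle (suc s) (Adj E) → ¬ Cycle (suc s) (Adj ((u , v) ∷ E))
  extend-acyclic {v} {E} {u} s 2≤s v∉ acyc C = acyc record
    { c = c ; injective = injective ; periodic = periodic
    ; adjacent = λ i → case adjacent i of λ where
        (inj₁ (there p))   → inj₁ p
        (inj₂ (there p))   → inj₂ p
        (inj₁ (here eq)) → ⊥-elim (v∉ (subst₂ (λ x y → y ∈ reach E s x) (cong proj₁ eq) (cong proj₂ eq)
          (backward i (inj₁ (cong proj₁ eq , cong proj₂ eq)))))
        (inj₂ (here eq)) → ⊥-elim (v∉ (subst₂ (λ x y → y ∈ reach E s x) (cong proj₁ eq) (cong proj₂ eq)
          (forward i (inj₂ (cong proj₂ eq , cong proj₁ eq)))))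
    }
    where
    open Cycle C
    New : ℕ → Set
    New i = (c i ≡ u × c (suc i) ≡ v) ⊎ (c i ≡ v × c (suc i) ≡ u)

    back : ∀ i → c (suc i + s) ≡ c i
    back i = trans (cong c (sym (+-suc i s))) (periodic i)

    -- Opposite traversals of one edge: for `j > i + 1` a vertex repeats too early, and for
    -- `j ≡ i + 1` the cycle would turn back at once, which `2 ≤ s` excludes.
    flipped : ∀ i {j} → i < j → j < i + suc s → c i ≡ c (suc j) → c (suc i) ≡ c j → ⊥
    flipped i {j} i<j j<i+ e₁ e₂ with m≤n⇒m<n∨m≡n i<j
    ... | inj₁ si<j = injective si<j (m<n⇒m<1+n j<i+) e₂
    ... | inj₂ refl = injective (m<n⇒m<1+n ≤-refl)
            (≤-trans (≤-reflexive (+-comm 3 i)) (+-monoʳ-≤ i (s≤s 2≤s))) e₁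

    clash : ∀ i → New i → ∀ {j} → i < j → j < i + suc s → New j → ⊥
    clash i (inj₁ (a , b)) p q (inj₁ (a′ , b′)) = injective p q (trans a (sym a′))
    clash i (inj₁ (a , b)) p q (inj₂ (a′ , b′)) = flipped i p q (trans a (sym b′)) (trans b (sym a′))
    clash i (inj₂ (a , b)) p q (inj₁ (a′ , b′)) = flipped i p q (trans a (sym b′)) (trans b (sym a′))
    clash i (inj₂ (a , b)) p q (inj₂ (a′ , b′)) = injective p q (trans a (sym a′))

    -- One turn starting after the new edge at index `i`: by `clash` the remaining `s` edges are
    -- old.
    old : ∀ i → New i → ∀ k → k < s → Adj E (c (suc i + k)) (c (suc i + suc k))
    old i new k k<s = subst (Adj E (c (suc i + k))) (cong c (sym (+-suc (suc i) k)))
      (case adjacent (suc i + k) of λ where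
        (inj₁ (there p)) → inj₁ p
        (inj₂ (there p)) → inj₂ p
        (inj₁ (here eq)) → ⊥-elim (clash i new lo hi (inj₁ (cong proj₁ eq , cong proj₂ eq)))
        (inj₂ (here eq)) → ⊥-elim (clash i new lo hi (inj₂ (cong proj₂ eq , cong proj₁ eq))))
      where
      lo : i < suc i + k
      lo = s≤s (m≤m+n i k)
      hi : suc i + k < i + suc s
      hi = ≤-trans (≤-reflexive (sym (cong suc (+-suc i k)))) (≤-trans (≤-reflexive (sym (+-suc i (suc k)))) (+-monoʳ-≤ i (s≤s k<s)))

    forward : ∀ i → New i → c i ∈ reach E s (c (suc i))
    forward i new = subst₂ (λ x y → y ∈ reach E s x) (cong c (+-identityʳ (suc i))) (back i)
      (walk-reach s (λ k → c (suc i + k)) (old i new))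

    backward : ∀ i → New i → c (suc i) ∈ reach E s (c i)
    backward i new = subst₂ (λ x y → y ∈ reach E s x) (back i) (cong c (+-identityʳ (suc i)))
      (walk-reach-reverse s (λ k → c (suc i + k)) (old i new))

  -- If every vertex of `C` lay in `B` or already had in-degree at least `D`, the first kind would
  -- contribute at most `length B * D` to `length C * D`, and the second at most `length E`.
  free-vertex : ∀ E B C D → Unique E → Unique C → length E + length B * D < length C * D →
                ∃[ v ] v ∈ C × v ∉ B × length (ins E v) < D
  free-vertex E B C D uE uC bound
    with Any.any? (λ v → ¬? (v ∈? B) ×-dec (length (ins E v) <? D)) C
  ... | yes p = let v , v∈ , v∉ , d = find p in v , v∈ , v∉ , d
  ... | no ¬p = ⊥-elim (<⇒≱ bound (begin
    length C * D                   ≡⟨ cong (_* D) (length-filter-¬ (_∈? B) C) ⟩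
    (length C₁ + length C₂) * D    ≡⟨ *-distribʳ-+ D (length C₁) (length C₂) ⟩
    length C₁ * D + length C₂ * D  ≤⟨ +-mono-≤ (*-monoˡ-≤ D C₁≤) C₂≤ ⟩
    length B * D + length E        ≡⟨ +-comm (length B * D) _ ⟩
    length E + length B * D        ∎))
    where
    open ≤-Reasoning
    C₁ = filter (_∈? B) C
    C₂ = filter (λ v → ¬? (v ∈? B)) C
    C₁≤ : length C₁ ≤ length B
    C₁≤ = length-⊆ (Unique.filter⁺ (_∈? B) uC) (λ x∈ → proj₂ (∈-filter⁻ (_∈? B) {xs = C} x∈))
    into : V → List (V × V)
    into v = filter (λ e → proj₂ e ≟ v) E
    full : ∀ {v} → v ∈ C₂ → D ≤ length (into v)
    full {v} v∈ with ∈-filter⁻ (λ v → ¬? (v ∈? B)) {xs = C} v∈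
    ... | v∈C , v∉B = ≮⇒≥ (λ lt → All.lookup (¬Any⇒All¬ C ¬p) v∈C
            (v∉B , subst (_< D) (sym (length-map proj₁ (into v))) lt))
    C₂≤ : length C₂ * D ≤ length E
    C₂≤ = ≤-trans (length-concatMap-≥ D into C₂ full)
      (length-⊆ (Unique-concatMap into (just ∘ proj₂) (Unique.filter⁺ _ uC)
                  (λ v → Unique.filter⁺ _ uE)
                  (λ v e∈ → cong just (proj₂ (∈-filter⁻ (λ e → proj₂ e ≟ v) {xs = E} e∈))))
        (λ e∈ → let v , _ , e∈′ = ∈-concatMap⁻′ into C₂ e∈ in proj₁ (∈-filter⁻ (λ e → proj₂ e ≟ v) {xs = E} e∈′)))

  length-outs : ∀ E u → length (outs E u) ≡ length (filter (_≟ u) (map proj₁ E))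
  length-outs []            u = refl
  length-outs ((a , b) ∷ E) u with a ≟ u
  ... | yes _ = cong suc (length-outs E u)
  ... | no  _ = length-outs E u

  -- The list of tails is prescribed, and with it all out-degrees; only the heads are open.
  -- `acyclic` forbids just the cycles of length `suc s`, in the underlying undirected graph.
  record AcyclicDigraph (cand : V → List V) (D s : ℕ) (tails : List V) : Set where
    field
      edges   : List (V × V)
      tails≡  : map proj₁ edges ≡ tails
      heads   : ∀ {u v} → (u , v) ∈ edges → v ∈ cand u
      unique  : Unique edges
      indeg   : ∀ v → length (ins edges v) ≤ D
      acyclic : ¬ Cycle (suc s) (Adj edges)

  -- Edges are added one at a time. As all degrees stay at most `q + D`, at most `(q + D) ^ s` heads
  -- could close a cycle, and `free-vertex` always finds a head.
  greedy : ∀ cand {q D s M} → 2 ≤ s → (∀ u → Unique (cand u)) → (∀ u → length (cand u) ≡ M) →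
           ∀ ts → (∀ u → length (filter (_≟ u) ts) ≤ q) →
           length ts + ((q + D) ^ s + q) * D ≤ M * D → AcyclicDigraph cand D s ts
  greedy cand 2≤s uc lc [] mult bound = record
    { edges = [] ; tails≡ = refl ; heads = λ () ; unique = [] ; indeg = λ v → z≤n
    ; acyclic = λ C → case Cycle.adjacent C 0 of λ { (inj₁ ()) ; (inj₂ ()) } }
  greedy cand {q} {D} {s} {M} 2≤s uc lc (t ∷ ts) mult bound = record
    { edges = (t , w) ∷ edges
    ; tails≡ = cong (t ∷_) tails≡
    ; heads = λ { (here refl) → w∈ ; (there e∈) → heads e∈ }
    ; unique = All.tabulate (λ { e∈ refl → w∉ (∈-++⁺ʳ (reach edges s t) (∈-outs⁺ e∈)) }) ∷ unique
    ; indeg = indeg′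
    ; acyclic = extend-acyclic s 2≤s (w∉ ∘ ∈-++⁺ˡ) acyclic }
    where
    mult′ : ∀ u → length (filter (_≟ u) ts) ≤ q
    mult′ u with t ≟ u | mult u
    ... | yes _ | m = ≤-trans (n≤1+n _) m
    ... | no  _ | m = m
    open AcyclicDigraph (greedy cand {q} {D} {s} {M} 2≤s uc lc ts mult′ (≤-trans (n≤1+n _) bound))
    outdeg : ∀ u → length (outs edges u) ≤ q
    outdeg u = ≤-trans (≤-reflexive (trans (length-outs edges u) (cong (length ∘ filter (_≟ u)) tails≡))) (mult′ u)
    deg : ∀ u → length (nbrs edges u) ≤ q + D
    deg u = ≤-trans (≤-reflexive (length-++ (outs edges u))) (+-mono-≤ (outdeg u) (indeg u))
    -- The first part prevents a cycle of length `suc s`, the second a repeated edge.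
    banned = reach edges s t ++ outs edges t
    banned≤ : length banned ≤ (q + D) ^ s + q
    banned≤ = ≤-trans (≤-reflexive (length-++ (reach edges s t))) (+-mono-≤ (length-reach {edges} deg s t) (outdeg t))
    lE : length edges ≡ length ts
    lE = trans (sym (length-map proj₁ edges)) (cong length tails≡)
    choice : ∃[ v ] v ∈ cand t × v ∉ banned × length (ins edges v) < D
    choice = free-vertex edges banned (cand t) D unique (uc t) (begin-strict
      length edges + length banned * D          ≤⟨ +-mono-≤ (≤-reflexive lE) (*-monoˡ-≤ D banned≤) ⟩
      length ts + ((q + D) ^ s + q) * D <⟨ ≤-refl ⟩
      suc (length ts) + ((q + D) ^ s + q) * D ≤⟨ bound ⟩
      M * D                            ≡⟨ cong (_* D) (sym (lc t)) ⟩
      length (cand t) * D ∎)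
      where open ≤-Reasoning
    w = proj₁ choice
    w∈ = proj₁ (proj₂ choice)
    w∉ = proj₁ (proj₂ (proj₂ choice))
    indeg′ : ∀ x → length (ins ((t , w) ∷ edges) x) ≤ D
    indeg′ x with w ≟ x
    ... | yes refl = proj₂ (proj₂ (proj₂ choice))
    ... | no  _    = indeg x

-- Disjoint walks in a layered digraph

module _ {V : Set} (_≟_ : DecidableEquality V) where

  filter-replicate-≡ : ∀ q u → length (filter (_≟ u) (replicate q u)) ≡ q
  filter-replicate-≡ q u = trans (cong length (filter-all (_≟ u) (replicate⁺ q refl))) (length-replicate q)

  filter-replicate-≢ : ∀ q {u v} → v ≢ u → length (filter (_≟ u) (replicate q v)) ≡ 0
  filter-replicate-≢ q v≢u = cong length (filter-none (_≟ _) (replicate⁺ q v≢u))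

  length-filter-blocks : ∀ q u v vs → length (filter (_≟ u) (concatMap (replicate q) (v ∷ vs))) ≡
    length (filter (_≟ u) (replicate q v)) + length (filter (_≟ u) (concatMap (replicate q) vs))
  length-filter-blocks q u v vs = trans (cong length (filter-++ (_≟ u) (replicate q v) _))
    (length-++ (filter (_≟ u) (replicate q v)))

  multiplicity-∉ : ∀ q {u} vs → u ∉ vs → length (filter (_≟ u) (concatMap (replicate q) vs)) ≡ 0
  multiplicity-∉ q [] u∉ = refl
  multiplicity-∉ q {u} (v ∷ vs) u∉ = trans (length-filter-blocks q u v vs)
    (cong₂ _+_ (filter-replicate-≢ q (λ v≡u → u∉ (here (sym v≡u)))) (multiplicity-∉ q vs (u∉ ∘ there)))

  multiplicity-≤ : ∀ q u {vs} → Unique vs → length (filter (_≟ u) (concatMap (replicate q) vs)) ≤ q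
  multiplicity-≤ q u [] = z≤n
  multiplicity-≤ q u {v ∷ vs} (v∉ ∷ uv) with v ≟ u
  ... | yes refl = ≤-reflexive (trans (length-filter-blocks q u v vs) (trans
          (cong₂ _+_ (filter-replicate-≡ q u) (multiplicity-∉ q vs (λ v∈ → All.lookup v∉ v∈ refl))) (+-identityʳ q)))
  ... | no v≢u = ≤-trans (≤-reflexive (trans (length-filter-blocks q u v vs)
          (cong (_+ _) (filter-replicate-≢ q v≢u)))) (multiplicity-≤ q u uv)

  multiplicity-≥ : ∀ q {u} vs → u ∈ vs → q ≤ length (filter (_≟ u) (concatMap (replicate q) vs))
  multiplicity-≥ q {u} (v ∷ vs) (here refl) = ≤-trans (m≤m+n q _) (≤-reflexive
    (sym (trans (length-filter-blocks q u v vs) (cong (_+ length (filter (_≟ u) (concatMap (replicate q) vs))) (filter-replicate-≡ q u)))))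
  multiplicity-≥ q {u} (v ∷ vs) (there u∈) = ≤-trans (multiplicity-≥ q vs u∈) (≤-trans (m≤n+m _ _)
    (≤-reflexive (sym (length-filter-blocks q u v vs))))

Vertex : ℕ → Set
Vertex M = ℕ × Fin M

_≟ᵥ_ : ∀ {M} → DecidableEquality (Vertex M)
_≟ᵥ_ = ≡-dec ℕ._≟_ Fin._≟_

record IsWalk {M} (T : ℕ) (E : List (Vertex M × Vertex M)) (w : List (Vertex M)) : Set where
  field
    length≡ : length w ≡ suc T
    level   : ∀ i {v} → at w i ≡ just v → proj₁ v ≡ i
    step    : ∀ i → i < T → ∃₂ λ v v′ → at w i ≡ just v × at w (suc i) ≡ just v′ × (v , v′) ∈ E

-- All that the coding needs to know of the digraph; `K` stands for the guaranteed number of choices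
-- for each walk of a tuple.
record WalkSystem (M T s K m : ℕ) : Set where
  open Digraph (_≟ᵥ_ {M}) using (Adj)
  field
    edges         : List (Vertex M × Vertex M)
    acyclic       : ¬ Cycle (suc s) (Adj edges)
    tuples        : List (List (List (Vertex M)))
    tuples-unique : Unique tuples
    tuples-many   : K ^ m ≤ length tuples
    tuple-length  : ∀ {t} → t ∈ tuples → length t ≡ m
    tuple-walks   : ∀ {t} → t ∈ tuples → All (IsWalk T edges) t
    disjoint      : ∀ {t} → t ∈ tuples → AllPairs Disjoint t

-- `room-edges` weighs the at most `T * M * q` edges and the banned heads against the in-degree
-- capacity `M * D` of a layer. In `room-walks`, a tuple uses at most `m * suc T` vertices, each on
-- at most `suc T * D ^ T` walks, while there are at least `M * q ^ T` walks.
module Construction (M T q D s m : ℕ) (2≤s : 2 ≤ s) (q≤D : q ≤ D)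
  (room-edges : T * M * q + ((q + D) ^ s + q) * D ≤ M * D)
  (room-walks : m * suc T * (suc T * D ^ T) + q ^ T ≤ M * q ^ T) where

  V = Vertex M
  open Digraph (_≟ᵥ_ {M})
  open import Data.List.Membership.DecPropositional (_≟ᵥ_ {M}) using (_∈?_)

  layer : ℕ → List V
  layer i = map (i ,_) (allFin M)

  sources : List V
  sources = concatMap layer (upTo T)

  length-layer : ∀ i → length (layer i) ≡ M
  length-layer i = trans (length-map _ (allFin M)) (length-tabulate id)

  Unique-layer : ∀ i → Unique (layer i)
  Unique-layer i = Unique.map⁺ (λ { refl → refl }) (Unique.allFin⁺ M)

  ∈-layer⁻ : ∀ i {v} → v ∈ layer i → proj₁ v ≡ i
  ∈-layer⁻ i v∈ with ∈-map⁻ _ v∈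
  ... | _ , _ , refl = refl

  Unique-sources : Unique sources
  Unique-sources = Unique-concatMap layer (just ∘ proj₁) (Unique.upTo⁺ T) Unique-layer
    (λ i v∈ → cong just (∈-layer⁻ i v∈))

  tails : List V
  tails = concatMap (replicate q) sources

  length-tails : length tails ≤ T * M * q
  length-tails = begin
    length tails              ≤⟨ length-concatMap-≤ q _ sources (λ _ → ≤-reflexive (length-replicate q)) ⟩
    length sources * q        ≤⟨ *-monoˡ-≤ q (length-concatMap-≤ M layer (upTo T) (λ {i} _ → ≤-reflexive (length-layer i))) ⟩
    length (upTo T) * M * q   ≡⟨ cong (λ l → l * M * q) (length-upTo T) ⟩
    T * M * q                 ∎
    where open ≤-Reasoning

  open AcyclicDigraph (greedy (layer ∘ suc ∘ proj₁) {q} {D} {s} {M} 2≤s (λ u → Unique-layer _) (λ u → length-layer _)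
    tails (λ u → multiplicity-≤ _≟ᵥ_ q u Unique-sources) (≤-trans (+-monoˡ-≤ _ length-tails) room-edges)) public

  next prev : V → List V
  next = outs edges
  prev = ins edges

  next-multiplicity : ∀ u → length (next u) ≡ length (filter (_≟ᵥ u) tails)
  next-multiplicity u = trans (length-outs edges u) (cong (length ∘ filter (_≟ᵥ u)) tails≡)

  length-next-≤ : ∀ u → length (next u) ≤ D
  length-next-≤ u = ≤-trans (≤-reflexive (next-multiplicity u))
    (≤-trans (multiplicity-≤ _≟ᵥ_ q u Unique-sources) q≤D)

  length-next-≥ : ∀ u → proj₁ u < T → q ≤ length (next u)
  length-next-≥ u i<T = ≤-trans
    (multiplicity-≥ _≟ᵥ_ q sources (∈-concatMap⁺ layer (lose (∈-upTo⁺ i<T) (∈-map⁺ _ (∈-allFin (proj₂ u))))))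
    (≤-reflexive (sym (next-multiplicity u)))

  next-level : ∀ {u v} → v ∈ next u → proj₁ v ≡ suc (proj₁ u)
  next-level v∈ = ∈-layer⁻ _ (heads (∈-outs⁻ v∈))

  length-chains-≥ : ∀ r u → proj₁ u + r ≤ T → q ^ r ≤ length (chains next r u)
  length-chains-≥ zero    u h = ≤-refl
  length-chains-≥ (suc r) u h = ≤-trans
    (*-monoˡ-≤ (q ^ r) (length-next-≥ u (≤-trans (≤-reflexive (+-comm 1 _)) (≤-trans (+-monoʳ-≤ (proj₁ u) (s≤s z≤n)) h))))
    (length-concatMap-≥ (q ^ r) _ (next u) λ {v} v∈ → ≤-trans
      (length-chains-≥ r v (≤-trans (≤-reflexive (trans (cong (_+ r) (next-level v∈)) (sym (+-suc (proj₁ u) r)))) h))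
      (≤-reflexive (sym (length-map _ (chains next r v)))))

  walksFrom : Fin M → List (List V)
  walksFrom x = map ((0 , x) ∷_) (chains next T (0 , x))

  walks : List (List V)
  walks = concatMap walksFrom (allFin M)

  Unique-walks : Unique walks
  Unique-walks = Unique-concatMap walksFrom (Maybe.map proj₂ ∘ head) (Unique.allFin⁺ M)
    (λ x → Unique.map⁺ (λ { refl → refl }) (Unique-chains (Unique-outs unique) T (0 , x)))
    λ x w∈ → case ∈-map⁻ _ w∈ of λ { (_ , _ , refl) → refl }

  length-walks : M * q ^ T ≤ length walks
  length-walks = subst (λ l → l * q ^ T ≤ length walks) (length-tabulate {n = M} id)
    (length-concatMap-≥ (q ^ T) walksFrom (allFin M) λ {x} _ →
      ≤-trans (length-chains-≥ T (0 , x) ≤-refl) (≤-reflexive (sym (length-map _ (chains next T (0 , x))))))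

  ∈-walks⁻ : ∀ {w} → w ∈ walks → ∃₂ λ x vs → w ≡ (0 , x) ∷ vs × Chain next (0 , x) vs × length vs ≡ T
  ∈-walks⁻ w∈ with ∈-concatMap⁻′ walksFrom (allFin M) w∈
  ... | x , _ , w∈′ with ∈-map⁻ _ w∈′
  ... | vs , vs∈ , refl = x , vs , refl , ∈-chains⁻ T vs∈

  chain-level : ∀ {u vs} → Chain next u vs → ∀ i {v} → at (u ∷ vs) i ≡ just v → proj₁ v ≡ proj₁ u + i
  chain-level ch       zero    refl = sym (+-identityʳ _)
  chain-level {u} (v∈ ∷ ch) (suc i) eq = trans (chain-level ch i eq)
    (trans (cong (_+ i) (next-level v∈)) (sym (+-suc (proj₁ u) i)))

  chain-step : ∀ {u vs} → Chain next u vs → ∀ i → i < length vs →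
    ∃₂ λ v v′ → at (u ∷ vs) i ≡ just v × at (u ∷ vs) (suc i) ≡ just v′ × (v , v′) ∈ edges
  chain-step (v∈ ∷ ch) zero    _       = _ , _ , refl , refl , ∈-outs⁻ v∈
  chain-step (v∈ ∷ ch) (suc i) (s≤s p) = chain-step ch i p

  isWalk : ∀ {w} → w ∈ walks → IsWalk T edges w
  isWalk w∈ with ∈-walks⁻ w∈
  ... | x , vs , refl , ch , refl = record
    { length≡ = refl ; level = chain-level ch ; step = chain-step ch }

  -- The chain `p` runs backwards from `v`, hence the reversing append.
  glue : V → ℕ → List (List V)
  glue v i = concatMap (λ p → map (λ r → p ʳ++ (v ∷ r)) (chains next (T ∸ i) v)) (chains prev i v)

  -- Every position `i` is tried for `v`, whatever its level; this costs only the factor `suc T`.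
  through : V → List (List V)
  through v = concatMap (glue v) (upTo (suc T))

  length-through : ∀ v → length (through v) ≤ suc T * D ^ T
  length-through v = subst (λ l → length (through v) ≤ l * D ^ T) (length-upTo (suc T))
    (length-concatMap-≤ (D ^ T) (glue v) (upTo (suc T)) λ {i} i∈ → begin
      length (glue v i)
        ≤⟨ length-concatMap-≤ (D ^ (T ∸ i)) _ (chains prev i v)
             (λ _ → ≤-trans (≤-reflexive (length-map _ (chains next (T ∸ i) v))) (length-chains-≤ length-next-≤ (T ∸ i) v)) ⟩
      length (chains prev i v) * D ^ (T ∸ i) ≤⟨ *-monoˡ-≤ _ (length-chains-≤ prev≤ i v) ⟩
      D ^ i * D ^ (T ∸ i) ≡⟨ sym (^-distribˡ-+-* D i (T ∸ i)) ⟩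
      D ^ (i + (T ∸ i)) ≡⟨ cong (D ^_) (m+[n∸m]≡n (≤-pred (∈-upTo⁻ i∈))) ⟩
      D ^ T ∎)
    where
    open ≤-Reasoning
    prev≤ : ∀ u → length (prev u) ≤ D
    prev≤ = indeg

  -- The recursion moves along the walk as a zipper: `past` is the part already traversed, in
  -- reverse, and becomes the backward chain once `v` is met.
  split-chain : ∀ {u v} past {vs} → Chain prev u past → Chain next u vs → v ∈ u ∷ vs →
    ∃₂ λ p r → past ʳ++ (u ∷ vs) ≡ p ʳ++ (v ∷ r) × Chain prev v p × Chain next v r ×
               length p + length r ≡ length past + length vs
  split-chain past {vs} pa ch (here refl) = past , vs , refl , pa , ch , refl
  split-chain {u} past {x ∷ vs} pa (x∈ ∷ ch) (there v∈) =
    let p , r , eq , cp , cr , l = split-chain (u ∷ past) (∈-ins⁺ {E = edges} (∈-outs⁻ {E = edges} x∈) ∷ pa) ch v∈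
    in p , r , eq , cp , cr , trans l (sym (+-suc (length past) (length vs)))

  ∈-through : ∀ {w v} → w ∈ walks → v ∈ w → w ∈ through v
  ∈-through {v = v} w∈ v∈ with ∈-walks⁻ w∈
  ... | x , vs , refl , ch , refl with split-chain [] [] ch v∈
  ... | p , r , eq , cp , cr , l = ∈-concatMap⁺ (glue v) (lose
    (∈-upTo⁺ (s≤s (≤-trans (m≤m+n (length p) (length r)) (≤-reflexive l))))
    (∈-concatMap⁺ _ (lose (∈-chains⁺ cp) (subst (_∈ map (λ r → p ʳ++ (v ∷ r)) _) (sym eq)
      (∈-map⁺ _ (subst (λ k → r ∈ chains next k v)
        (sym (trans (cong (_∸ length p) (sym l)) (m+n∸m≡n (length p) (length r)))) (∈-chains⁺ cr)))))))

  used : List (List V) → List V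
  used = concatMap id

  avoids? : ∀ t → Decidable (All (_∉ used t))
  avoids? t = all? (λ v → ¬? (v ∈? used t))

  fresh : List (List V) → List (List V)
  fresh t = filter (avoids? t) walks

  -- A walk that is not fresh runs through a used vertex, so the lists `through v` of the used
  -- vertices `v` cover all walks that are lost.
  length-fresh : ∀ t → length t ≤ m → (∀ {w} → w ∈ t → w ∈ walks) → q ^ T ≤ length (fresh t)
  length-fresh t t≤m t⊆ = +-cancelˡ-≤ (m * suc T * (suc T * D ^ T)) _ _ (begin
    m * suc T * (suc T * D ^ T) + q ^ T ≤⟨ room-walks ⟩
    M * q ^ T ≤⟨ length-walks ⟩
    length walks ≤⟨ length-⊆ Unique-walks cover ⟩
    length (concatMap through (used t) ++ fresh t) ≡⟨ length-++ (concatMap through (used t)) ⟩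
    length (concatMap through (used t)) + length (fresh t)
      ≤⟨ +-monoˡ-≤ _ (length-concatMap-≤ _ through (used t) (λ {v} _ → length-through v)) ⟩
    length (used t) * (suc T * D ^ T) + length (fresh t)
      ≤⟨ +-monoˡ-≤ _ (*-monoˡ-≤ _ (≤-trans (length-concatMap-≤ (suc T) id t
           (λ w∈ → ≤-reflexive (IsWalk.length≡ (isWalk (t⊆ w∈))))) (*-monoˡ-≤ (suc T) t≤m))) ⟩
    m * suc T * (suc T * D ^ T) + length (fresh t) ∎)
    where
    open ≤-Reasoning
    cover : ∀ {w} → w ∈ walks → w ∈ concatMap through (used t) ++ fresh t
    cover {w} w∈ with avoids? t w
    ... | yes a = ∈-++⁺ʳ (concatMap through (used t)) (∈-filter⁺ (avoids? t) w∈ a)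
    ... | no ¬a with find (¬All⇒Any¬ (λ v → ¬? (v ∈? used t)) w ¬a)
    ... | v , v∈w , ¬v∉ = ∈-++⁺ˡ (∈-concatMap⁺ through
            (lose (decidable-stable (v ∈? used t) ¬v∉) (∈-through w∈ v∈w)))

  extensions : List (List V) → List (List (List V))
  extensions t = map (_∷ t) (fresh t)

  tuplesOf : ℕ → List (List (List V))
  tuplesOf zero    = [ [] ]
  tuplesOf (suc b) = concatMap extensions (tuplesOf b)

  ∈-tuples⁻ : ∀ b {t} → t ∈ tuplesOf b → length t ≡ b × All (_∈ walks) t × AllPairs Disjoint t
  ∈-tuples⁻ zero    (here refl) = refl , [] , []
  ∈-tuples⁻ (suc b) t∈ with ∈-concatMap⁻′ extensions (tuplesOf b) t∈
  ... | t′ , t′∈ , p with ∈-map⁻ _ p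
  ... | w , w∈ , refl with ∈-tuples⁻ b t′∈ | ∈-filter⁻ (avoids? t′) {xs = walks} w∈
  ... | l , ws , ds | w∈W , av = cong suc l , w∈W ∷ ws ,
    All.tabulate (λ {w′} w′∈ {v} (v∈w , v∈w′) → All.lookup av v∈w (∈-concatMap⁺ id (lose w′∈ v∈w′))) ∷ ds

  Unique-tuples : ∀ b → Unique (tuplesOf b)
  Unique-tuples zero    = [] ∷ []
  Unique-tuples (suc b) = Unique-concatMap extensions tail (Unique-tuples b)
    (λ t → Unique.map⁺ (λ { refl → refl }) (Unique.filter⁺ (avoids? t) Unique-walks))
    λ t t∈ → case ∈-map⁻ _ t∈ of λ { (_ , _ , refl) → refl }

  length-tuples : ∀ b → b ≤ m → (q ^ T) ^ b ≤ length (tuplesOf b)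
  length-tuples zero    _   = ≤-refl
  length-tuples (suc b) b<m = ≤-trans
    (≤-trans (≤-reflexive (*-comm (q ^ T) _)) (*-monoˡ-≤ (q ^ T) (length-tuples b (≤-trans (n≤1+n b) b<m))))
    (length-concatMap-≥ (q ^ T) extensions (tuplesOf b) λ {t} t∈ →
      let l , ws , _ = ∈-tuples⁻ b t∈ in
      ≤-trans (length-fresh t (≤-trans (≤-reflexive l) (≤-trans (n≤1+n b) b<m)) (All.lookup ws))
        (≤-reflexive (sym (length-map (_∷ t) (fresh t)))))

  walkSystem : WalkSystem M T s (q ^ T) m
  walkSystem = record
    { edges = edges
    ; acyclic = acyclic
    ; tuples = tuplesOf m
    ; tuples-unique = Unique-tuples m
    ; tuples-many = length-tuples m ≤-refl
    ; tuple-length = λ t∈ → proj₁ (∈-tuples⁻ m t∈)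
    ; tuple-walks = λ t∈ → All.map isWalk (proj₁ (proj₂ (∈-tuples⁻ m t∈)))
    ; disjoint = λ t∈ → proj₂ (proj₂ (∈-tuples⁻ m t∈))
    }

-- Agreement of two paths on a stretch

EdgeAt : List A → A → A → Set
EdgeAt p a b = ∃[ j ] ((at p j ≡ just a × at p (suc j) ≡ just b) ⊎ (at p j ≡ just b × at p (suc j) ≡ just a))

UnionAt : List A → List A → A → A → Set
UnionAt p p′ a b = EdgeAt p a b ⊎ EdgeAt p′ a b

Extends : List A → List A → Set
Extends P p = ∀ i {x} → at P i ≡ just x → at p i ≡ just x

consec-at : ∀ {P : List A} {a b} → Consec P a b → ∃[ j ] at P j ≡ just a × at P (suc j) ≡ just b
consec-at here        = 0 , refl , refl
consec-at (there con) = let j , p , q = consec-at con in suc j , p , q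

pathEdge-at : ∀ {n} {P p : List (Fin n)} → Extends P p → ∀ {a b} → PathEdge P a b → EdgeAt p a b
pathEdge-at ext (inj₁ con) = let j , x , y = consec-at con in j , inj₁ (ext j x , ext (suc j) y)
pathEdge-at ext (inj₂ con) = let j , x , y = consec-at con in j , inj₂ (ext j x , ext (suc j) y)

at-++ˡ : ∀ (P Q : List A) → Extends P (P ++ Q)
at-++ˡ (x ∷ P) Q zero    eq = eq
at-++ˡ (x ∷ P) Q (suc i) eq = at-++ˡ P Q i eq

-- Completion to Hamiltonian paths and unrolling of cycles

module _ {n : ℕ} where

  open import Data.List.Membership.DecPropositional (Fin._≟_ {n}) using (_∈?_)

  -- Missing vertices are appended at the end, one for each unit of `d`, so all positions and hence
  -- all edges of `P` survive, and a creating pair stays creating.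
  hamiltonian : ∀ d (P : List (Fin n)) → Unique P → length P + d ≡ n →
                ∃[ p ] Unique p × length p ≡ n × Extends P p
  hamiltonian zero    P uP l = P , uP , trans (sym (+-identityʳ _)) l , λ i eq → eq
  hamiltonian (suc d) P uP l with Fin.any? (λ a → ¬? (a ∈? P))
  ... | yes (a , a∉) =
    let p , up , lp , ext = hamiltonian d (P ++ [ a ])
          (Unique.++⁺ uP ([] ∷ []) (λ { (x∈ , here refl) → a∉ x∈ }))
          (trans (cong (_+ d) (length-++ P)) (trans (+-assoc (length P) 1 d) l))
    in p , up , lp , λ i eq → ext i (at-++ˡ P [ a ] i eq)
  ... | no ¬∃ = ⊥-elim (<⇒≱ short (≤-trans (≤-reflexive (sym (length-tabulate {n = n} id)))
    (length-⊆ (Unique.allFin⁺ n) (λ {a} _ → decidable-stable (a ∈? P) (λ a∉ → ¬∃ (a , a∉))))))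
    where
    short : length P < n
    short = ≤-trans (≤-reflexive (+-comm 1 (length P)))
      (≤-trans (+-monoʳ-≤ (length P) (s≤s z≤n)) (≤-reflexive l))

module _ {n s : ℕ} {_~_ : Fin n → Fin n → Set} where

  private
    ℓ = suc s

  cycle : ContainsCycle ℓ _~_ → Cycle ℓ _~_
  cycle (c , inj , steps , close) = record
    { c = λ i → c (i mod ℓ) ; adjacent = adjacent
    ; injective = λ {i} {j} i<j j<i+ℓ eq → distinct i<j j<i+ℓ (trans (sym (toℕ-mod i)) (trans (cong toℕ (inj eq)) (toℕ-mod j)))
    ; periodic = λ i → cong c (Fin.toℕ-injective (trans (toℕ-mod (i + ℓ)) (trans
        (trans (cong (λ x → (i + x) % ℓ) (sym (*-identityˡ ℓ))) ([m+kn]%n≡m%n i 1 ℓ)) (sym (toℕ-mod i))))) }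
    where
    toℕ-mod : ∀ i → toℕ (i mod ℓ) ≡ i % ℓ
    toℕ-mod i = Fin.toℕ-fromℕ< _

    suc-% : ∀ i → suc i % ℓ ≡ suc (i % ℓ) % ℓ
    suc-% i = trans (cong (λ x → suc x % ℓ) (m≡m%n+[m/n]*n i ℓ)) ([m+kn]%n≡m%n (suc (i % ℓ)) (i / ℓ) ℓ)

    adjacent : ∀ i → c (i mod ℓ) ~ c (suc i mod ℓ)
    adjacent i with m≤n⇒m<n∨m≡n (≤-pred (m%n<n i ℓ))
    ... | inj₁ r<s = subst₂ (λ x y → c x ~ c y)
      (Fin.toℕ-injective (trans (Fin.toℕ-inject₁ _) (trans (Fin.toℕ-fromℕ< r<s) (sym (toℕ-mod i)))))
      (Fin.toℕ-injective (trans (cong suc (Fin.toℕ-fromℕ< r<s))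
        (sym (trans (toℕ-mod (suc i)) (trans (suc-% i) (m<n⇒m%n≡m (s≤s r<s)))))))
      (steps (fromℕ< r<s))
    ... | inj₂ r≡s = subst₂ (λ x y → c x ~ c y)
      (Fin.toℕ-injective (trans (Fin.toℕ-fromℕ s) (trans (sym r≡s) (sym (toℕ-mod i)))))
      (Fin.toℕ-injective (sym (trans (toℕ-mod (suc i)) (trans (suc-% i) (trans (cong (λ x → suc x % ℓ) r≡s) (n%n≡0 ℓ))))))
      close

    -- Equal remainders and `i < j` force a larger quotient for `j`, hence `i + ℓ ≤ j`.
    distinct : ∀ {i j} → i < j → j < i + ℓ → i % ℓ ≢ j % ℓ
    distinct {i} {j} i<j j<i+ℓ eq = <⇒≱ j<i+ℓ (begin
      i + ℓ                              ≡⟨ cong (_+ ℓ) (m≡m%n+[m/n]*n i ℓ) ⟩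
      i % ℓ + i / ℓ * ℓ + ℓ              ≡⟨ +-assoc (i % ℓ) _ _ ⟩
      i % ℓ + (i / ℓ * ℓ + ℓ)            ≡⟨ cong₂ _+_ eq (+-comm (i / ℓ * ℓ) ℓ) ⟩
      j % ℓ + suc (i / ℓ) * ℓ            ≤⟨ +-monoʳ-≤ (j % ℓ) (*-monoˡ-≤ ℓ quot<) ⟩
      j % ℓ + j / ℓ * ℓ                  ≡⟨ sym (m≡m%n+[m/n]*n j ℓ) ⟩
      j                                  ∎)
      where
      open ≤-Reasoning
      quot< : i / ℓ < j / ℓ
      quot< = *-cancelʳ-< ℓ (i / ℓ) (j / ℓ) (+-cancelˡ-< (i % ℓ) _ _
        (subst₂ _<_ (m≡m%n+[m/n]*n i ℓ) (trans (m≡m%n+[m/n]*n j ℓ) (cong (_+ j / ℓ * ℓ) (sym eq))) i<j))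

-- Inside a stretch where both paths agree, every inner vertex has only its two
-- path neighbours, so a cycle using an edge of the stretch swallows all of it.
module Stretch {A : Set} {s : ℕ} (2≤s : 2 ≤ s) {p p′ : List A} (up : Unique p) (up′ : Unique p′)
  (C : Cycle (suc s) (UnionAt p p′)) where

  open Cycle C

  On : ℕ → Set
  On x = ∃[ i ] at p x ≡ just (c i)

  neighbour : ∀ {y a b} → at p y ≡ at p′ y → at p (suc y) ≡ at p′ (suc y) → at p (suc (suc y)) ≡ at p′ (suc (suc y)) →
              at p (suc y) ≡ just a → UnionAt p p′ b a → at p y ≡ just b ⊎ at p (suc (suc y)) ≡ just b
  neighbour {y} e₀ e₁ e₂ pa (inj₁ (k , inj₁ (kb , ka))) with suc-injective (at-injective up (suc y) (suc k) pa ka)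
  ... | refl = inj₁ kb
  neighbour {y} e₀ e₁ e₂ pa (inj₁ (k , inj₂ (ka , kb))) with at-injective up (suc y) k pa ka
  ... | refl = inj₂ kb
  neighbour {y} e₀ e₁ e₂ pa (inj₂ (k , inj₁ (kb , ka))) with suc-injective (at-injective up′ (suc y) (suc k) (trans (sym e₁) pa) ka)
  ... | refl = inj₁ (trans e₀ kb)
  neighbour {y} e₀ e₁ e₂ pa (inj₂ (k , inj₂ (ka , kb))) with at-injective up′ (suc y) k (trans (sym e₁) pa) ka
  ... | refl = inj₂ (trans e₂ kb)

  sym-union : ∀ {a b} → UnionAt p p′ a b → UnionAt p p′ b a
  sym-union (inj₁ (j , e)) = inj₁ (j , swap e)
  sym-union (inj₂ (j , e)) = inj₂ (j , swap e)

  -- The predecessor and the successor on the cycle are distinct, and both are among the two path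
  -- neighbours of the position, so each path neighbour is one of them.
  spread : ∀ {y} → at p y ≡ at p′ y → at p (suc y) ≡ at p′ (suc y) → at p (suc (suc y)) ≡ at p′ (suc (suc y)) →
           On (suc y) → On y × On (suc (suc y))
  spread {y} e₀ e₁ e₂ (i , pi) = result
    (neighbour e₀ e₁ e₂ pi′ (adjacent (i + s)))
    (neighbour e₀ e₁ e₂ pi′ (sym-union (adjacent (suc (i + s)))))
    where
    -- The index is moved on by a full period, so that it has the predecessor `i + s`.
    pi′ : at p (suc y) ≡ just (c (suc (i + s)))
    pi′ = trans pi (cong just (sym (trans (cong c (sym (+-suc i s))) (periodic i))))
    apart : c (i + s) ≢ c (suc (suc (i + s)))
    apart = injective (m<n⇒m<1+n ≤-refl) (≤-trans (≤-reflexive (+-comm 3 (i + s))) (+-monoʳ-≤ (i + s) (s≤s 2≤s)))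
    result : at p y ≡ just (c (i + s)) ⊎ at p (suc (suc y)) ≡ just (c (i + s)) →
             at p y ≡ just (c (suc (suc (i + s)))) ⊎ at p (suc (suc y)) ≡ just (c (suc (suc (i + s)))) →
             On y × On (suc (suc y))
    result (inj₁ x) (inj₁ y) = ⊥-elim (apart (just-injective (trans (sym x) y)))
    result (inj₁ x) (inj₂ y) = (_ , x) , (_ , y)
    result (inj₂ x) (inj₁ y) = (_ , y) , (_ , x)
    result (inj₂ x) (inj₂ y) = ⊥-elim (apart (just-injective (trans (sym x) y)))

  c-% : ∀ i → c i ≡ c (i % suc s)
  c-% i = trans (cong c (m≡m%n+[m/n]*n i (suc s))) (go (i % suc s) (i / suc s))
    where
    go : ∀ r a → c (r + a * suc s) ≡ c r
    go r zero    = cong c (+-identityʳ r)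
    go r (suc a) = trans (cong c (trans (cong (r +_) (+-comm (suc s) _)) (sym (+-assoc r _ _))))
      (trans (periodic (r + a * suc s)) (go r a))

  -- Starting from the two ends of an edge of `p`, `spread` carries the cycle down to `σ` and up to
  -- `τ`. It would then contain at least `s + 2` vertices of the stretch, but it has only `s + 1`.
  avoids-stretch : ∀ {σ τ j i i′} → (∀ x → σ ≤ x → x ≤ τ → at p x ≡ at p′ x) → σ + suc s ≤ τ →
                   σ ≤ j → j < τ → at p j ≡ just (c i) → at p (suc j) ≡ just (c i′) → ⊥
  avoids-stretch {σ} {τ} {j} {i} {i′} agree long σ≤j j<τ pj psj = clash
    where
    descend : ∀ d x → σ ≤ x → x + d ≡ j → On x
    descend zero    x σ≤x eq rewrite +-identityʳ x | eq = i , pj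
    descend (suc d) x σ≤x eq = proj₁ (spread (agree x σ≤x (≤-trans (n≤1+n x) (<⇒≤ sx<τ))) (agree (suc x) (m≤n⇒m≤1+n σ≤x) (<⇒≤ sx<τ))
        (agree (suc (suc x)) (m≤n⇒m≤1+n (m≤n⇒m≤1+n σ≤x)) sx<τ) (descend d (suc x) (m≤n⇒m≤1+n σ≤x) eq′))
      where
      eq′ = trans (sym (+-suc x d)) eq
      sx<τ : suc x < τ
      sx<τ = ≤-<-trans (≤-trans (m≤m+n (suc x) d) (≤-reflexive eq′)) j<τ
    ascend : ∀ d → suc (j + d) ≤ τ → On (suc (j + d))
    ascend zero    h rewrite +-identityʳ j = i′ , psj
    ascend (suc d) h rewrite +-suc j d = proj₂ (spread (agree (j + d) σ≤ (≤-trans (m≤n⇒m≤1+n (n≤1+n _)) h))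
        (agree (suc (j + d)) (m≤n⇒m≤1+n σ≤) (≤-trans (n≤1+n _) h))
        (agree (suc (suc (j + d))) (m≤n⇒m≤1+n (m≤n⇒m≤1+n σ≤)) h) (ascend d (≤-trans (n≤1+n _) h)))
      where
      σ≤ : σ ≤ j + d
      σ≤ = ≤-trans σ≤j (m≤m+n j d)
    on : ∀ x → σ ≤ x → x ≤ τ → On x
    on x σ≤x x≤τ with x ≤? j
    ... | yes x≤j = descend (j ∸ x) x σ≤x (m+[n∸m]≡n x≤j)
    ... | no  x≰j = subst On (m+[n∸m]≡n (≰⇒> x≰j)) (ascend (x ∸ suc j) (≤-trans (≤-reflexive (m+[n∸m]≡n (≰⇒> x≰j))) x≤τ))
    onᵈ : ∀ (d : Fin (suc (suc s))) → On (σ + toℕ d)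
    onᵈ d = on _ (m≤m+n σ _) (≤-trans (+-monoʳ-≤ σ (≤-pred (Fin.toℕ<n d))) long)
    clash : ⊥
    clash with Fin.pigeonhole ≤-refl (λ d → proj₁ (onᵈ d) mod suc s)
    ... | d , d′ , d<d′ , eq = <⇒≢ d<d′ (+-cancelˡ-≡ σ _ _ (at-injective up _ _ (proj₂ (onᵈ d))
      (trans (proj₂ (onᵈ d′)) (cong just (trans (c-% _) (trans (cong c (sym same)) (sym (c-% _))))))))
      where
      same : proj₁ (onᵈ d) % suc s ≡ proj₁ (onᵈ d′) % suc s
      same = trans (sym (Fin.toℕ-fromℕ< _)) (trans (cong toℕ eq) (Fin.toℕ-fromℕ< _))

-- Coding pairs of a path and a tuple of walks

-- This is the partial map `g ∘ p⁻¹` on vertices, computed by searching `p`.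
readAlong : ∀ {n} {B : Set} → List (Fin n) → (ℕ → Maybe B) → Fin n → Maybe B
readAlong []      g a = nothing
readAlong (x ∷ p) g a with x Fin.≟ a
... | yes _ = g 0
... | no  _ = readAlong p (g ∘ suc) a

module _ {n : ℕ} {B : Set} where

  readAlong-at : ∀ {p : List (Fin n)} (g : ℕ → Maybe B) → Unique p → ∀ j {a} → at p j ≡ just a → readAlong p g a ≡ g j
  readAlong-at {x ∷ p} g (x∉ ∷ u) zero    {a} refl with x Fin.≟ x
  ... | yes _  = refl
  ... | no x≢x = contradiction refl x≢x
  readAlong-at {x ∷ p} g (x∉ ∷ u) (suc j) {a} eq with x Fin.≟ a
  ... | yes refl = contradiction refl (All.lookup x∉ (at-∈ p j eq))
  ... | no _     = readAlong-at (g ∘ suc) u j eq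

  readAlong-just : ∀ (p : List (Fin n)) (g : ℕ → Maybe B) {a v} → readAlong p g a ≡ just v →
                   ∃[ j ] at p j ≡ just a × g j ≡ just v
  readAlong-just (x ∷ p) g {a} eq with x Fin.≟ a
  ... | yes refl = 0 , refl , eq
  ... | no _     = let j , pj , gj = readAlong-just p (g ∘ suc) eq in suc j , pj , gj

>>=-just : ∀ {A B : Set} (x : Maybe A) {f : A → Maybe B} {v} → (x >>= f) ≡ just v → ∃[ w ] x ≡ just w × f w ≡ just v
>>=-just (just w) eq = w , refl , eq

module _ (b : ℕ) {i S : ℕ} .{{_ : NonZero S}} (i<S : i < S) where

  block-% : (i + b * S) % S ≡ i
  block-% = trans ([m+kn]%n≡m%n i b S) (m<n⇒m%n≡m i<S)

  block-/ : (i + b * S) / S ≡ b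
  block-/ = trans (+-distrib-/-∣ʳ i (divides-refl b)) (cong₂ _+_ (m<n⇒m/n≡0 i<S) (m*n/n≡m b S))

disjoint-at : ∀ {A : Set} {t : List (List A)} → AllPairs Disjoint t → ∀ b b′ {w w′ v} →
              at t b ≡ just w → at t b′ ≡ just w′ → v ∈ w → v ∈ w′ → b ≡ b′
disjoint-at (d ∷ ds) zero    zero     p    q    _  _   = refl
disjoint-at (d ∷ ds) zero    (suc b′) refl q    v∈ v∈′ = ⊥-elim (All.lookup d (at-∈ _ b′ q) (v∈ , v∈′))
disjoint-at (d ∷ ds) (suc b) zero     p    refl v∈ v∈′ = ⊥-elim (All.lookup d (at-∈ _ b p) (v∈′ , v∈))
disjoint-at (d ∷ ds) (suc b) (suc b′) p    q    v∈ v∈′ = cong suc (disjoint-at ds b b′ p q v∈ v∈′)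

funToFin-injective : ∀ {m n} (f g : Fin m → Fin n) → funToFin f ≡ funToFin g → ∀ i → f i ≡ g i
funToFin-injective f g eq i =
  trans (sym (Fin.finToFun-funToFin f i)) (trans (cong (λ k → Fin.finToFun k i) eq) (Fin.finToFun-funToFin g i))

-- A path is cut into m blocks of length S = T + ℓ: the positions T , … , S of each
-- block and everything after the last block are recorded verbatim, while the
-- positions 0 , … , T of the blocks are mapped along the walks of a tuple.
module Coding {M T s K m n : ℕ} (2≤s : 2 ≤ s) (W : WalkSystem M T s K m)
  (n≤ : n ≤ suc T * M) (1≤m : 1 ≤ m) (blocks< : m * (T + suc s) < n) (n≤blocks : n ≤ m * (T + suc s) + (T + suc s)) where

  open WalkSystem W
  open Digraph (_≟ᵥ_ {M}) using (Adj)

  V = Vertex M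
  Tuple = List (List V)

  S : ℕ
  S = T + suc s

  T<S : T < S
  T<S = ≤-trans (≤-reflexive (+-comm 1 T)) (+-monoʳ-≤ T (s≤s z≤n))

  instance
    S≢0 : NonZero S
    S≢0 = >-nonZero (≤-trans (s≤s z≤n) T<S)

  -- The walks of a tuple have positions `0` to `T` only, so `g t` is undefined inside the windows
  -- and beyond the last block.
  g : Tuple → ℕ → Maybe V
  g t j = at t (j / S) >>= λ w → at w (j % S)

  g-block : ∀ t b {i w} → i < S → at t b ≡ just w → g t (i + b * S) ≡ at w i
  g-block t b i<S eq rewrite block-/ b i<S | block-% b i<S | eq = refl

  module _ {t} (t∈ : t ∈ tuples) where

    walk : ∀ {b w} → at t b ≡ just w → IsWalk T edges w
    walk {b} eq = All.lookup (tuple-walks t∈) (at-∈ t b eq)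

    g-level : ∀ j {v} → g t j ≡ just v → proj₁ v ≡ j % S × proj₁ v ≤ T
    g-level j eq with >>=-just (at t (j / S)) eq
    ... | w , tb , wi = lv , ≤-trans (≤-reflexive lv) (≤-pred (≤-trans (at-< w (j % S) wi) (≤-reflexive (IsWalk.length≡ (walk tb)))))
      where lv = IsWalk.level (walk tb) (j % S) wi

    -- The level of a vertex gives the offset in the block, and the disjointness of the walks gives
    -- the block.
    g-injective : ∀ j j′ {v} → g t j ≡ just v → g t j′ ≡ just v → j ≡ j′
    g-injective j j′ eq eq′ with >>=-just (at t (j / S)) eq | >>=-just (at t (j′ / S)) eq′
    ... | w , tb , wi | w′ , tb′ , wi′ = begin
      j                    ≡⟨ m≡m%n+[m/n]*n j S ⟩
      j % S + j / S * S    ≡⟨ cong₂ (λ i b → i + b * S) (trans (sym (proj₁ (g-level j eq))) (proj₁ (g-level j′ eq′)))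
                                (disjoint-at (disjoint t∈) (j / S) (j′ / S) tb tb′ (at-∈ w _ wi) (at-∈ w′ _ wi′)) ⟩
      j′ % S + j′ / S * S  ≡⟨ sym (m≡m%n+[m/n]*n j′ S) ⟩
      j′ ∎
      where open ≡-Reasoning

    g-step : ∀ j → j / S < m → j % S < T → ∃₂ λ v v′ → g t j ≡ just v × g t (suc j) ≡ just v′ × (v , v′) ∈ edges
    g-step j b<m i<T with <-at t (j / S) (≤-trans b<m (≤-reflexive (sym (tuple-length t∈))))
    ... | w , tb with IsWalk.step (walk tb) (j % S) i<T
    ... | v , v′ , wi , wsi , e = v , v′ , trans (cong (_>>= _) tb) wi ,
      trans (cong (g t ∘ suc) (m≡m%n+[m/n]*n j S)) (trans (g-block t (j / S) (≤-<-trans i<T T<S) tb) wsi) , e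

  -- Every walk occupies positions of some block, and by `blocks<` all of these are below `n`.
  g-determines : ∀ {t t′} → t ∈ tuples → t′ ∈ tuples → (∀ j {v} → j < n → g t j ≡ just v → g t′ j ≡ just v) → t ≡ t′
  g-determines {t} {t′} t∈ t′∈ h = at-ext t t′ (trans (tuple-length t∈) (sym (tuple-length t′∈))) λ b w tb →
    let b<m = ≤-trans (at-< t b tb) (≤-reflexive (tuple-length t∈))
        w′ , tb′ = <-at t′ b (≤-trans b<m (≤-reflexive (sym (tuple-length t′∈))))
        lw = IsWalk.length≡ (walk t∈ tb)
    in trans tb′ (cong just (sym (at-ext w w′ (trans lw (sym (IsWalk.length≡ (walk t′∈ tb′)))) λ i v wi →
      let i<S = ≤-<-trans (≤-pred (≤-trans (at-< w i wi) (≤-reflexive lw))) T<S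
      in trans (sym (g-block t′ b i<S tb′)) (h (i + b * S)
           (<-trans (<-≤-trans (+-monoˡ-< (b * S) i<S) (*-monoˡ-≤ S b<m)) blocks<)
           (trans (g-block t b i<S tb) wi)))))

  -- One alphabet for images and labels alike, with an extra symbol for `nothing`; `n≤` makes the
  -- labels fit.
  N : ℕ
  N = suc (suc T * M)

  encodeVertex : Maybe V → Fin N
  encodeVertex nothing = Fin.zero
  encodeVertex (just (i , x)) with i <? suc T
  ... | yes i<T = Fin.suc (combine (fromℕ< i<T) x)
  ... | no  _   = Fin.zero

  -- It is enough that one side has a level in range: everything else, `nothing` included, gets the
  -- symbol zero, which no vertex in range gets.
  encodeVertex-injective : ∀ {v z} → proj₁ v ≤ T → encodeVertex (just v) ≡ encodeVertex z → z ≡ just v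
  encodeVertex-injective {i , x} {nothing} i≤T eq with i <? suc T
  ... | no i≮ = contradiction (s≤s i≤T) i≮
  encodeVertex-injective {i , x} {just (i′ , x′)} i≤T eq with i <? suc T | i′ <? suc T
  ... | no i≮   | _       = contradiction (s≤s i≤T) i≮
  ... | yes i<T | yes i′<T = cong just (sym (cong₂ _,_
        (trans (sym (Fin.toℕ-fromℕ< i<T)) (trans (cong toℕ (proj₁ c)) (Fin.toℕ-fromℕ< i′<T))) (proj₂ c)))
    where c = Fin.combine-injective (fromℕ< i<T) x (fromℕ< i′<T) x′ (Fin.suc-injective eq)

  encodeLabel : Maybe (Fin n) → Fin N
  encodeLabel nothing  = Fin.zero
  encodeLabel (just a) = Fin.suc (inject≤ a n≤)

  encodeLabel-injective : ∀ {x y} → encodeLabel x ≡ encodeLabel y → x ≡ y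
  encodeLabel-injective {nothing} {nothing} eq = refl
  encodeLabel-injective {just a}  {just b}  eq = cong just (Fin.inject≤-injective n≤ n≤ a b (Fin.suc-injective eq))

  Path = List (Fin n)

  -- The `s + 2` positions at offsets `T` to `S` span the `s + 1` edges of a window; the last one
  -- opens the next block or the tail.
  windowAt : Path → Fin m × Fin (suc (suc s)) → Fin N
  windowAt p (b , i) = encodeLabel (at p (T + toℕ i + toℕ b * S))

  code₁ : Path → Tuple → Fin n → Fin N
  code₁ p t = encodeVertex ∘ readAlong p (g t)

  code₂ : Path → Fin (m * suc (suc s)) → Fin N
  code₂ p = windowAt p ∘ remQuot (suc (suc s))

  code₃ : Path → Fin (suc S) → Fin N
  code₃ p i = encodeLabel (at p (m * S + toℕ i))

  Codes : ℕ
  Codes = N ^ n * (N ^ (m * suc (suc s)) * N ^ suc S)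

  code : Path → Tuple → Fin Codes
  code p t = combine (funToFin (code₁ p t)) (combine (funToFin (code₂ p)) (funToFin (code₃ p)))

  module SameCode {p p′ t t′} (up : Unique p) (up′ : Unique p′) (lp : length p ≡ n) (lp′ : length p′ ≡ n)
    (t∈ : t ∈ tuples) (t′∈ : t′ ∈ tuples) (eq : code p t ≡ code p′ t′) where

    private
      eqs = Fin.combine-injective (funToFin (code₁ p t)) _ (funToFin (code₁ p′ t′)) _ eq
      eqs′ = Fin.combine-injective (funToFin (code₂ p)) _ (funToFin (code₂ p′)) _ (proj₂ eqs)

    same-image : ∀ a → encodeVertex (readAlong p (g t) a) ≡ encodeVertex (readAlong p′ (g t′) a)
    same-image = funToFin-injective (code₁ p t) (code₁ p′ t′) (proj₁ eqs)

    same-window : ∀ b i → b < m → i ≤ suc s → at p (T + i + b * S) ≡ at p′ (T + i + b * S)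
    same-window b i b<m i≤ = subst₂ (λ b i → at p (T + i + b * S) ≡ at p′ (T + i + b * S))
      (Fin.toℕ-fromℕ< b<m) (Fin.toℕ-fromℕ< (s≤s i≤)) (encodeLabel-injective
        (subst (λ x → windowAt p x ≡ windowAt p′ x) (Fin.remQuot-combine (fromℕ< b<m) (fromℕ< (s≤s i≤)))
          (funToFin-injective (code₂ p) (code₂ p′) (proj₁ eqs′) (combine (fromℕ< b<m) (fromℕ< (s≤s i≤))))))

    same-tail : ∀ i → i ≤ S → at p (m * S + i) ≡ at p′ (m * S + i)
    same-tail i i≤ = subst (λ i → at p (m * S + i) ≡ at p′ (m * S + i)) (Fin.toℕ-fromℕ< (s≤s i≤))
      (encodeLabel-injective (funToFin-injective (code₃ p) (code₃ p′) (proj₂ eqs′) (fromℕ< (s≤s i≤))))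

    image : Fin n → Maybe V
    image = readAlong p (g t)

    image-p : ∀ j {a v} → at p j ≡ just a → g t j ≡ just v → image a ≡ just v
    image-p j pj gj = trans (readAlong-at (g t) up j pj) gj

    -- By the equality of the first codes, `image` extends `g t′ ∘ p′⁻¹` as well, so a single
    -- injection serves both paths.
    image-p′ : ∀ j {a v} → at p′ j ≡ just a → g t′ j ≡ just v → image a ≡ just v
    image-p′ j {a} {v} pj gj = encodeVertex-injective (proj₂ (g-level t′∈ j gj))
      (trans (cong encodeVertex (sym (trans (readAlong-at (g t′) up′ j pj) gj))) (sym (same-image a)))

    image-injective : ∀ {a a′ v} → image a ≡ just v → image a′ ≡ just v → a ≡ a′
    image-injective e e′ with readAlong-just p (g t) e | readAlong-just p (g t) e′
    ... | j , pj , gj | j′ , pj′ , gj′ with g-injective t∈ j j′ gj gj′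
    ... | refl = just-injective (trans (sym pj) pj′)

    Mapped : Fin n → Fin n → Set
    Mapped a b = ∃₂ λ v v′ → image a ≡ just v × image b ≡ just v′ × Adj edges v v′

    agree-window : ∀ b → b < m → ∀ x → T + b * S ≤ x → x ≤ T + b * S + suc s → at p x ≡ at p′ x
    agree-window b b<m x lo hi = subst (λ x → at p x ≡ at p′ x) eq′ (same-window b i b<m i≤)
      where
      i = x ∸ (T + b * S)
      i≤ : i ≤ suc s
      i≤ = +-cancelˡ-≤ (T + b * S) i (suc s) (≤-trans (≤-reflexive (m+[n∸m]≡n lo)) hi)
      eq′ : T + i + b * S ≡ x
      eq′ = trans (trans (+-assoc T i _) (trans (cong (T +_) (+-comm i _)) (sym (+-assoc T _ i)))) (m+[n∸m]≡n lo)

    -- The step from `j` to `suc j` lies either on a mapped segment or in a stretch of at least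
    -- `suc s` edges on which the paths agree, where no cycle can use it.
    locate : ∀ j → suc j < n → (j / S < m × j % S < T) ⊎
      ∃₂ λ σ τ → (∀ x → σ ≤ x → x ≤ τ → at p x ≡ at p′ x) × σ + suc s ≤ τ × σ ≤ j × j < τ
    locate j sj<n with j <? m * S
    ... | yes j< with j % S <? T
    ...   | yes i<T = inj₁ (b<m , i<T)
      where b<m = m<n*o⇒m/o<n {j} {m} {S} j<
    ...   | no i≮T = inj₂ (T + b * S , T + b * S + suc s , agree-window b b<m , ≤-refl , σ≤j , j<τ)
      where
      b = j / S
      b<m = m<n*o⇒m/o<n {j} {m} {S} j<
      σ≤j : T + b * S ≤ j
      σ≤j = ≤-trans (+-monoˡ-≤ (b * S) (≮⇒≥ i≮T)) (≤-reflexive (sym (m≡m%n+[m/n]*n j S)))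
      j<τ : j < T + b * S + suc s
      j<τ = <-≤-trans (≤-<-trans (≤-reflexive (m≡m%n+[m/n]*n j S)) (+-monoˡ-< (b * S) (m%n<n j S)))
        (≤-reflexive (trans (+-assoc T (suc s) _) (trans (cong (T +_) (+-comm (suc s) _)) (sym (+-assoc T _ _)))))
    -- The part after the last block may be short, so the stretch is started at the window of the
    -- last block, which ends at `m * S`.
    locate j sj<n | no j≮ = inj₂ (T + b * S , suc j , agree , long , ≤-trans (m≤m+n _ (suc s)) (≤-trans long′ (≮⇒≥ j≮)) , ≤-refl)
      where
      b = pred m
      sb≡m : suc b ≡ m
      sb≡m = suc-pred m {{>-nonZero 1≤m}}
      end≡ : T + b * S + suc s ≡ m * S
      end≡ = trans (trans (+-assoc T _ _) (trans (cong (T +_) (+-comm _ (suc s))) (sym (+-assoc T (suc s) _)))) (cong (_* S) sb≡m)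
      long′ : T + b * S + suc s ≤ m * S
      long′ = ≤-reflexive end≡
      long : T + b * S + suc s ≤ suc j
      long = ≤-trans long′ (m≤n⇒m≤1+n (≮⇒≥ j≮))
      agree : ∀ x → T + b * S ≤ x → x ≤ suc j → at p x ≡ at p′ x
      agree x lo hi with x ≤? m * S
      ... | yes x≤ = agree-window b (≤-reflexive sb≡m) x lo (≤-trans x≤ (≤-reflexive (sym end≡)))
      ... | no x≰ = subst (λ x → at p x ≡ at p′ x) (m+[n∸m]≡n mS≤x) (same-tail (x ∸ m * S)
          (+-cancelˡ-≤ (m * S) _ _ (≤-trans (≤-reflexive (m+[n∸m]≡n mS≤x)) (≤-trans hi (≤-trans (<⇒≤ sj<n) n≤blocks)))))
        where mS≤x = <⇒≤ (≰⇒> x≰)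

    -- The cycle uses no edge of a stretch of agreement, so each of its edges lies on a mapped
    -- segment; `image` then carries it injectively to a cycle of the same length in the digraph.
    noncreating : ¬ Cycle (suc s) (UnionAt p p′)
    noncreating C = acyclic record
      { c = λ i → proj₁ (mapped i)
      ; adjacent = λ i → let _ , v′ , _ , im′ , e = mapped i in
          subst (Adj edges _) (just-injective (trans (sym im′) (im (suc i)))) e
      ; injective = λ {i} {j} i<j j<i+ℓ e → injective i<j j<i+ℓ (image-injective (im i) (trans (im j) (cong just (sym e))))
      ; periodic = λ i → just-injective (trans (sym (im (i + suc s))) (trans (cong image (periodic i)) (im i)))
      }
      where
      open Cycle C
      open Stretch 2≤s up up′ C using (avoids-stretch)

      transfer : ∀ j {a b} → j / S < m → j % S < T → at p j ≡ just a → at p (suc j) ≡ just b → Mapped a b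
      transfer j b<m i<T pj psj = let v , v′ , gj , gsj , e = g-step t∈ j b<m i<T in
        v , v′ , image-p j pj gj , image-p (suc j) psj gsj , inj₁ e

      transfer′ : ∀ j {a b} → j / S < m → j % S < T → at p′ j ≡ just a → at p′ (suc j) ≡ just b → Mapped a b
      transfer′ j b<m i<T pj psj = let v , v′ , gj , gsj , e = g-step t′∈ j b<m i<T in
        v , v′ , image-p′ j pj gj , image-p′ (suc j) psj gsj , inj₁ e

      flip : ∀ {a b} → Mapped a b → Mapped b a
      flip (v , v′ , x , y , e) = v′ , v , y , x , swap e

      edge : ∀ j {i i′} → at p j ≡ just (c i) → at p (suc j) ≡ just (c i′) → Mapped (c i) (c i′)
      edge j pj psj with locate j (≤-trans (at-< p (suc j) psj) (≤-reflexive lp))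
      ... | inj₁ (b<m , i<T) = transfer j b<m i<T pj psj
      ... | inj₂ (σ , τ , agree , long , lo , hi) = ⊥-elim (avoids-stretch agree long lo hi pj psj)

      edge′ : ∀ j {i i′} → at p′ j ≡ just (c i) → at p′ (suc j) ≡ just (c i′) → Mapped (c i) (c i′)
      edge′ j pj psj with locate j (≤-trans (at-< p′ (suc j) psj) (≤-reflexive lp′))
      ... | inj₁ (b<m , i<T) = transfer′ j b<m i<T pj psj
      -- On the stretch, positions of `p′` are positions of `p`, to which `avoids-stretch` applies.
      ... | inj₂ (σ , τ , agree , long , lo , hi) = ⊥-elim (avoids-stretch agree long lo hi
              (trans (agree j lo (<⇒≤ hi)) pj) (trans (agree (suc j) (m≤n⇒m≤1+n lo) hi) psj))

      mapped : ∀ i → Mapped (c i) (c (suc i))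
      mapped i with adjacent i
      ... | inj₁ (j , inj₁ (x , y)) = edge j {i} {suc i} x y
      ... | inj₁ (j , inj₂ (x , y)) = flip (edge j {suc i} {i} x y)
      ... | inj₂ (j , inj₁ (x , y)) = edge′ j {i} {suc i} x y
      ... | inj₂ (j , inj₂ (x , y)) = flip (edge′ j {suc i} {i} x y)

      im : ∀ i → image (c i) ≡ just (proj₁ (mapped i))
      im i = proj₁ (proj₂ (proj₂ (mapped i)))

    -- When the paths coincide, the common image recovers `g t` at all positions below `n`, and
    -- these values determine the tuple.
    same-tuple : p ≡ p′ → t ≡ t′
    same-tuple refl = g-determines t∈ t′∈ λ j j<n gj →
      let a , pj = <-at p j (≤-trans j<n (≤-reflexive (sym lp)))
      in trans (sym (readAlong-at (g t′) up j pj))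
           (encodeVertex-injective (proj₂ (g-level t∈ j gj))
             (trans (cong encodeVertex (sym (trans (readAlong-at (g t) up j pj) gj))) (same-image a)))

  -- The counting bound for a creating family

  module _ (F : List (List (Fin n))) (paths : All IsPath F)
    (creating : ∀ (i j : Fin (length F)) → i ≢ j → Creating (suc s) (lookup F i) (lookup F j)) where

    completion : ∀ i → ∃[ p ] Unique p × length p ≡ n × Extends (lookup F i) p
    completion i = hamiltonian (n ∸ length P) P uP (m+[n∸m]≡n
      (≤-trans (length-⊆ uP (λ {a} _ → ∈-allFin a)) (≤-reflexive (length-tabulate id))))
      where
      P = lookup F i
      uP : Unique P
      uP = proj₁ (All.lookup paths (∈-lookup i))

    pairCode : Fin (length F) × Fin (length tuples) → Fin Codes
    pairCode (i , k) = code (proj₁ (completion i)) (lookup tuples k)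

    -- Two pairs with one code have the same member of `F` by `noncreating`, and then the same tuple
    -- by `same-tuple`.
    pairCode-injective : ∀ x y → pairCode x ≡ pairCode y → x ≡ y
    pairCode-injective (i , k) (j , l) eq with i Fin.≟ j
    ... | yes refl = cong (i ,_) (lookup-injective tuples-unique k l (same-tuple refl))
      where
      u = proj₁ (proj₂ (completion i))
      lp = proj₁ (proj₂ (proj₂ (completion i)))
      open SameCode u u lp lp (∈-lookup k) (∈-lookup l) eq
    ... | no i≢j = ⊥-elim (noncreating (record
        { c = Cycle.c C ; injective = Cycle.injective C ; periodic = Cycle.periodic C
        ; adjacent = λ x → case Cycle.adjacent C x of λ where
            (inj₁ e) → inj₁ (pathEdge-at {p = proj₁ (completion i)} (proj₂ (proj₂ (proj₂ (completion i)))) e)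
            (inj₂ e) → inj₂ (pathEdge-at {p = proj₁ (completion j)} (proj₂ (proj₂ (proj₂ (completion j)))) e) }))
      where
      C = cycle {_~_ = UnionEdge (lookup F i) (lookup F j)} (creating i j i≢j)
      open SameCode (proj₁ (proj₂ (completion i))) (proj₁ (proj₂ (completion j)))
        (proj₁ (proj₂ (proj₂ (completion i)))) (proj₁ (proj₂ (proj₂ (completion j)))) (∈-lookup k) (∈-lookup l) eq

    family-bound : length F * K ^ m ≤ Codes
    family-bound = ≤-trans (*-monoʳ-≤ (length F) tuples-many)
      (Fin.injective⇒≤ {f = pairCode ∘ remQuot (length tuples)} λ {x} {y} eq →
        trans (sym (Fin.combine-remQuot {length F} (length tuples) x))
          (trans (cong (λ z → combine (proj₁ z) (proj₂ z)) (pairCode-injective _ _ eq))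
            (Fin.combine-remQuot {length F} (length tuples) y)))

-- Choice of parameters

^-distribʳ-* : ∀ a b o → (a * b) ^ o ≡ a ^ o * b ^ o
^-distribʳ-* a b zero    = refl
^-distribʳ-* a b (suc o) = trans (cong (a * b *_) (^-distribʳ-* a b o)) (lemma a b (a ^ o) (b ^ o))
  where
  lemma : ∀ a b x y → a * b * (x * y) ≡ a * x * (b * y)
  lemma = solve-∀

^-cancelˡ-≤ : ∀ o .{{_ : NonZero o}} {a b} → a ^ o ≤ b ^ o → a ≤ b
^-cancelˡ-≤ o h = ≮⇒≥ (λ b<a → <⇒≱ (^-monoˡ-< o b<a) h)

integer-root : ∀ s n → ∃[ q ] q ^ suc s ≤ n × n < suc q ^ suc s
integer-root s zero = 0 , z≤n , m^n>0 1 (suc s)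
integer-root s (suc n) with integer-root s n
... | q , lo , hi with suc n <? suc q ^ suc s
... | yes h = q , m≤n⇒m≤1+n lo , h
... | no ¬h = suc q , ≮⇒≥ ¬h , ≤-<-trans hi (^-monoˡ-< (suc s) ≤-refl)

module _ (s Q : ℕ) (2≤s : 2 ≤ s) (0<Q : 0 < Q) where

  -- T is so large that at most n / (2LQ) positions are recorded; C₁ n is the size of
  -- a layer, large enough for both the greedy digraph and the greedy walks.
  private
    L = suc s
    T = suc (2 * Q * L + 2 * L * Q * suc L)
    S = T + L
    -- The part of the loss in `exponents` that does not grow with `m`.
    slack = 2 * Q * S + 2 * L * Q * suc S
    C₁ = 4 * suc (2 * T) ^ L + suc (suc T * suc T * (2 * T) ^ T)
    C₂ = suc (suc T * C₁)
    -- Collects the bounded bases: `2 ^ L` from rounding the root, and `C₂` from the alphabet with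
    -- an exponent of at most `2 * L * n`.
    C = 2 ^ L * C₂ ^ (2 * L)
    -- The first summand gives `slack < m`, the second `C ^ (2 * Q) ≤ n`, by which the bounded bases
    -- cost only a factor `n ^ n` in `conclusion`.
    threshold = suc (suc slack * S) + C ^ (2 * Q)
    instance
      Q≢0 : NonZero Q
      Q≢0 = >-nonZero 0<Q
      S≢0 : NonZero S
      S≢0 = _

  module Large (n : ℕ) (large : threshold ≤ n) where

    private
      instance
        n≢0 : NonZero n
        n≢0 = >-nonZero (≤-trans (s≤s z≤n) large)
      -- Dividing `pred n` instead of `n` keeps `m * S`, the last position of the last window,
      -- strictly below `n`.
      m = pred n / S
      M = C₁ * n
      root = integer-root s n
      q = proj₁ root
      -- With this factor the `T * M * q` edges take up half of the capacity `M * D`; the other half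
      -- is left for banned heads.
      D = 2 * T * q
      r = m * suc L + suc S

    q^L≤n : q ^ L ≤ n
    q^L≤n = proj₁ (proj₂ root)

    1≤q : 1 ≤ q
    1≤q with q | proj₂ (proj₂ root)
    ... | zero  | h = ⊥-elim (<⇒≱ h (≤-trans (≤-reflexive (^-zeroˡ L)) (≤-trans (s≤s z≤n) large)))
    ... | suc _ | _ = s≤s z≤n

    n≤2^L*q^L : n ≤ 2 ^ L * q ^ L
    n≤2^L*q^L = ≤-trans (<⇒≤ (proj₂ (proj₂ root))) (≤-trans
      (^-monoˡ-≤ L (≤-trans (+-monoˡ-≤ q 1≤q) (≤-reflexive (cong (q +_) (sym (+-identityʳ q))))))
      (≤-reflexive (^-distribʳ-* 2 q L)))

    slack<m : slack < m
    slack<m = ≤-trans (≤-reflexive (sym (m*n/n≡m (suc slack) S)))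
      (/-monoˡ-≤ S (≤-pred (≤-trans (≤-trans (m≤m+n _ (C ^ (2 * Q))) large) (≤-reflexive (sym (suc-pred n))))))

    blocks< : m * S < n
    blocks< = ≤-trans (s≤s (m/n*n≤m (pred n) S)) (≤-reflexive (suc-pred n))

    n≤blocks : n ≤ m * S + S
    n≤blocks = ≤-trans (≤-reflexive (trans (sym (suc-pred n)) (cong suc (m≡m%n+[m/n]*n (pred n) S))))
      (≤-trans (+-monoˡ-≤ (m * S) (m%n<n (pred n) S)) (≤-reflexive (+-comm S _)))

    m≤n : m ≤ n
    m≤n = ≤-trans (m≤m*n m S) (<⇒≤ blocks<)

    1≤n : 1 ≤ n
    1≤n = ≤-trans (s≤s z≤n) large

    room-edges : T * M * q + ((q + D) ^ s + q) * D ≤ M * D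
    room-edges = begin
      T * M * q + ((q + D) ^ s + q) * D ≤⟨ +-monoʳ-≤ (T * M * q) (*-monoˡ-≤ D (+-mono-≤ pow≤ q≤)) ⟩
      T * M * q + (X + X) * D           ≡⟨ lemma₁ T M q X ⟩
      T * (M + 4 * X) * q               ≤⟨ *-monoˡ-≤ q (*-monoʳ-≤ T (+-monoʳ-≤ M 4X≤M)) ⟩
      T * (M + M) * q                   ≡⟨ lemma₂ T M q ⟩
      M * D                             ∎
      where
      open ≤-Reasoning
      -- This is `(q + D) ^ L`, which bounds both `(q + D) ^ s` and `q` and, since `q ^ L ≤ n`, is
      -- at most linear in `n`.
      X = suc (2 * T) ^ L * q ^ L
      lemma₁ : ∀ T M q X → T * M * q + (X + X) * (2 * T * q) ≡ T * (M + 4 * X) * q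
      lemma₁ = solve-∀
      lemma₂ : ∀ T M q → T * (M + M) * q ≡ M * (2 * T * q)
      lemma₂ = solve-∀
      X≡ : (q + D) ^ L ≡ X
      X≡ = ^-distribʳ-* (suc (2 * T)) q L
      instance
        q+D≢0 : NonZero (q + D)
        q+D≢0 = >-nonZero (≤-trans 1≤q (m≤m+n q D))
      pow≤ : (q + D) ^ s ≤ X
      pow≤ = ≤-trans (^-monoʳ-≤ (q + D) (n≤1+n s)) (≤-reflexive X≡)
      q≤ : q ≤ X
      q≤ = ≤-trans (m≤m+n q D) (≤-trans (m≤m*n (q + D) ((q + D) ^ s) {{m^n≢0 (q + D) s}}) (≤-reflexive X≡))
      4X≤M : 4 * X ≤ M
      4X≤M = begin
        4 * (suc (2 * T) ^ L * q ^ L) ≡⟨ sym (*-assoc 4 (suc (2 * T) ^ L) (q ^ L)) ⟩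
        4 * suc (2 * T) ^ L * q ^ L   ≤⟨ *-mono-≤ (m≤m+n (4 * suc (2 * T) ^ L) _) q^L≤n ⟩
        C₁ * n                        ∎

    -- As `D` is a constant multiple of `q`, the factor `q ^ T` splits off on both sides, and the
    -- rest on the left is at most linear in `n`.
    room-walks : m * suc T * (suc T * D ^ T) + q ^ T ≤ M * q ^ T
    room-walks = begin
      m * suc T * (suc T * D ^ T) + q ^ T
        ≡⟨ cong (λ x → m * suc T * (suc T * x) + q ^ T) (^-distribʳ-* (2 * T) q T) ⟩
      m * suc T * (suc T * ((2 * T) ^ T * q ^ T)) + q ^ T
        ≡⟨ lemma m (suc T) ((2 * T) ^ T) (q ^ T) ⟩
      (suc T * suc T * (2 * T) ^ T * m + 1) * q ^ T
        ≤⟨ *-monoˡ-≤ (q ^ T) (+-mono-≤ (*-monoʳ-≤ (suc T * suc T * (2 * T) ^ T) m≤n) 1≤n) ⟩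
      (suc T * suc T * (2 * T) ^ T * n + n) * q ^ T
        ≡⟨ cong (_* q ^ T) (+-comm _ n) ⟩
      suc (suc T * suc T * (2 * T) ^ T) * n * q ^ T
        ≤⟨ *-monoˡ-≤ (q ^ T) (*-monoˡ-≤ n (m≤n+m _ (4 * suc (2 * T) ^ L))) ⟩
      M * q ^ T ∎
      where
      open ≤-Reasoning
      lemma : ∀ m t d x → m * t * (t * (d * x)) + x ≡ (t * t * d * m + 1) * x
      lemma = solve-∀

    codes : ∀ (F : List (List (Fin n))) → PairwiseCreating n L F → length F * (q ^ T) ^ m ≤ (C₂ * n) ^ (n + r)
    codes F (paths , creating) = begin
      length F * (q ^ T) ^ m               ≤⟨ family-bound F paths creating ⟩
      N ^ n * (N ^ (m * suc L) * N ^ suc S) ≡⟨ cong (N ^ n *_) (sym (^-distribˡ-+-* N (m * suc L) (suc S))) ⟩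
      N ^ n * N ^ r                         ≡⟨ sym (^-distribˡ-+-* N n r) ⟩
      N ^ (n + r)                           ≤⟨ ^-monoˡ-≤ (n + r) N≤ ⟩
      (C₂ * n) ^ (n + r)                    ∎
      where
      open ≤-Reasoning
      system : WalkSystem M T s (q ^ T) m
      system = Construction.walkSystem M T q D s m 2≤s (m≤n*m q (2 * T)) room-edges room-walks
      1≤C₁ : 1 ≤ C₁
      1≤C₁ = ≤-trans (s≤s z≤n) (m≤n+m _ (4 * suc (2 * T) ^ L))
      n≤M : n ≤ suc T * M
      n≤M = ≤-trans (≤-trans (≤-reflexive (sym (*-identityˡ n))) (*-monoˡ-≤ n 1≤C₁)) (m≤n*m M (suc T))
      open Coding 2≤s system n≤M (≤-trans (s≤s z≤n) slack<m) blocks< n≤blocks using (family-bound; N)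
      N≤ : N ≤ C₂ * n
      N≤ = +-mono-≤ 1≤n (≤-reflexive (sym (*-assoc (suc T) C₁ n)))

    T*m≤n : T * m ≤ n
    T*m≤n = ≤-trans (*-monoˡ-≤ m (m≤m+n T L)) (≤-trans (≤-reflexive (*-comm S m)) (<⇒≤ blocks<))

    -- Divided by `2 * Q`, this bounds the total loss `(n - T * m) + L * r` by `n / (2 * Q)`. The
    -- coefficient of `m` in the loss is `pred T` by the choice of `T`, and `slack < m` fills up the
    -- missing unit.
    exponents : 2 * Q * n + 2 * L * Q * r ≤ n + 2 * Q * (T * m)
    exponents = begin
      2 * Q * n + 2 * L * Q * r             ≤⟨ +-monoˡ-≤ (2 * L * Q * r) (*-monoʳ-≤ (2 * Q) n≤blocks) ⟩
      2 * Q * (m * S + S) + 2 * L * Q * r   ≡⟨ lemma Q m T L S ⟩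
      slack + m * pred T + 2 * Q * (T * m)  ≤⟨ +-monoˡ-≤ _ (+-monoˡ-≤ (m * pred T) (<⇒≤ slack<m)) ⟩
      m + m * pred T + 2 * Q * (T * m)      ≡⟨ cong (_+ 2 * Q * (T * m)) (trans (sym (*-suc m (pred T))) (*-comm m T)) ⟩
      T * m + 2 * Q * (T * m)               ≤⟨ +-monoˡ-≤ _ T*m≤n ⟩
      n + 2 * Q * (T * m)                   ∎
      where
      open ≤-Reasoning
      lemma : ∀ Q m T L S → 2 * Q * (m * (T + L) + S) + 2 * L * Q * (m * suc L + suc S) ≡
              2 * Q * S + 2 * L * Q * suc S + m * (2 * Q * L + 2 * L * Q * suc L) + 2 * Q * (T * m)
      lemma = solve-∀

    -- A crude bound, which is enough for the exponent of the constant `C₂`.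
    r≤n : r ≤ n
    r≤n = ≤-trans (+-monoʳ-≤ (m * suc L) (≤-trans S<slack (<⇒≤ slack<m)))
      (≤-trans (≤-reflexive (trans (+-comm (m * suc L) m) (sym (*-suc m (suc L)))))
      (≤-trans (*-monoʳ-≤ m (+-monoˡ-≤ L 2≤T)) (<⇒≤ blocks<)))
      where
      2LQ>0 : 1 ≤ 2 * L * Q
      2LQ>0 = *-mono-≤ {1} {2 * L} (s≤s z≤n) 0<Q
      S<slack : suc S ≤ slack
      S<slack = ≤-trans (≤-trans (≤-reflexive (sym (*-identityˡ (suc S)))) (*-monoˡ-≤ (suc S) 2LQ>0)) (m≤n+m _ (2 * Q * S))
      2≤T : 2 ≤ T
      2≤T = s≤s (≤-trans (*-mono-≤ {1} {2 * Q} (≤-trans 0<Q (m≤n*m Q 2)) (s≤s (z≤n {s}))) (m≤m+n (2 * Q * L) _))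

    -- The `L`-th power turns `q` into `q ^ L`, which is at least `n / 2 ^ L`; every bounded base
    -- goes into `C ^ n`.
    growth : ∀ X → X * (q ^ T) ^ m ≤ (C₂ * n) ^ (n + r) → X ^ L * n ^ (T * m) ≤ C ^ n * n ^ (L * (n + r))
    growth X h = begin
      X ^ L * n ^ (T * m)
        ≤⟨ *-monoʳ-≤ (X ^ L) (^-monoˡ-≤ (T * m) n≤2^L*q^L) ⟩
      X ^ L * (2 ^ L * q ^ L) ^ (T * m)
        ≡⟨ cong (X ^ L *_) (^-distribʳ-* (2 ^ L) (q ^ L) (T * m)) ⟩
      X ^ L * ((2 ^ L) ^ (T * m) * (q ^ L) ^ (T * m))
        ≡⟨ cong (λ y → X ^ L * ((2 ^ L) ^ (T * m) * y)) q-power ⟩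
      X ^ L * ((2 ^ L) ^ (T * m) * ((q ^ T) ^ m) ^ L)
        ≡⟨ swap-middle (X ^ L) ((2 ^ L) ^ (T * m)) (((q ^ T) ^ m) ^ L) ⟩
      (2 ^ L) ^ (T * m) * (X ^ L * ((q ^ T) ^ m) ^ L)
        ≡⟨ cong ((2 ^ L) ^ (T * m) *_) (sym (^-distribʳ-* X ((q ^ T) ^ m) L)) ⟩
      (2 ^ L) ^ (T * m) * (X * (q ^ T) ^ m) ^ L
        ≤⟨ *-mono-≤ (^-monoʳ-≤ (2 ^ L) {{m^n≢0 2 L}} T*m≤n) (^-monoˡ-≤ L h) ⟩
      (2 ^ L) ^ n * ((C₂ * n) ^ (n + r)) ^ L
        ≡⟨ cong ((2 ^ L) ^ n *_) split ⟩
      (2 ^ L) ^ n * (C₂ ^ (L * (n + r)) * n ^ (L * (n + r)))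
        ≤⟨ *-monoʳ-≤ ((2 ^ L) ^ n) (*-monoˡ-≤ (n ^ (L * (n + r))) (^-monoʳ-≤ C₂ (*-monoʳ-≤ L (+-monoʳ-≤ n r≤n)))) ⟩
      (2 ^ L) ^ n * (C₂ ^ (L * (n + n)) * n ^ (L * (n + r)))
        ≡⟨ cong (λ e → (2 ^ L) ^ n * (C₂ ^ e * n ^ (L * (n + r)))) (double L n) ⟩
      (2 ^ L) ^ n * (C₂ ^ (2 * L * n) * n ^ (L * (n + r)))
        ≡⟨ sym (*-assoc ((2 ^ L) ^ n) _ _) ⟩
      (2 ^ L) ^ n * C₂ ^ (2 * L * n) * n ^ (L * (n + r))
        ≡⟨ cong (λ y → (2 ^ L) ^ n * y * n ^ (L * (n + r))) (sym (^-*-assoc C₂ (2 * L) n)) ⟩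
      (2 ^ L) ^ n * (C₂ ^ (2 * L)) ^ n * n ^ (L * (n + r))
        ≡⟨ cong (_* n ^ (L * (n + r))) (sym (^-distribʳ-* (2 ^ L) (C₂ ^ (2 * L)) n)) ⟩
      C ^ n * n ^ (L * (n + r)) ∎
      where
      open ≤-Reasoning
      swap-middle : ∀ x y z → x * (y * z) ≡ y * (x * z)
      swap-middle = solve-∀
      double : ∀ L n → L * (n + n) ≡ 2 * L * n
      double = solve-∀
      q-power : (q ^ L) ^ (T * m) ≡ ((q ^ T) ^ m) ^ L
      q-power = trans (^-*-assoc q L (T * m)) (trans (cong (q ^_) (*-comm L (T * m)))
        (trans (sym (^-*-assoc q (T * m) L)) (cong (_^ L) (sym (^-*-assoc q T m)))))
      split : ((C₂ * n) ^ (n + r)) ^ L ≡ C₂ ^ (L * (n + r)) * n ^ (L * (n + r))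
      split = trans (^-*-assoc (C₂ * n) (n + r) L) (trans (cong ((C₂ * n) ^_) (*-comm (n + r) L))
        (^-distribʳ-* C₂ n (L * (n + r))))

    -- Both sides are raised to the power `2 * Q`. The strict inequality of rates,
    -- `suc (Q * s) ≤ P * L`, leaves room for two summands `n` in the exponent: one absorbs `C`, the
    -- other the loss in `exponents`.
    conclusion : ∀ P X → Q * s < P * L → X ^ L * n ^ (T * m) ≤ C ^ n * n ^ (L * (n + r)) → X ^ Q ≤ n ^ (P * n)
    conclusion P X rate h = ^-cancelˡ-≤ (2 * L) (*-cancelʳ-≤ _ _ (n ^ (2 * Q * (T * m))) {{m^n≢0 n (2 * Q * (T * m))}} (begin
      (X ^ Q) ^ (2 * L) * n ^ (2 * Q * (T * m))
        ≡⟨ cong₂ _*_ (trans (^-*-assoc X Q (2 * L)) (trans (cong (X ^_) (e₁ Q L)) (sym (^-*-assoc X L (2 * Q)))))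
             (trans (cong (n ^_) (*-comm (2 * Q) (T * m))) (sym (^-*-assoc n (T * m) (2 * Q)))) ⟩
      (X ^ L) ^ (2 * Q) * (n ^ (T * m)) ^ (2 * Q)   ≡⟨ sym (^-distribʳ-* (X ^ L) (n ^ (T * m)) (2 * Q)) ⟩
      (X ^ L * n ^ (T * m)) ^ (2 * Q)               ≤⟨ ^-monoˡ-≤ (2 * Q) h ⟩
      (C ^ n * n ^ (L * (n + r))) ^ (2 * Q)         ≡⟨ ^-distribʳ-* (C ^ n) _ (2 * Q) ⟩
      (C ^ n) ^ (2 * Q) * (n ^ (L * (n + r))) ^ (2 * Q)
        ≡⟨ cong₂ _*_ (trans (^-*-assoc C n (2 * Q)) (trans (cong (C ^_) (*-comm n (2 * Q))) (sym (^-*-assoc C (2 * Q) n))))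
             (^-*-assoc n (L * (n + r)) (2 * Q)) ⟩
      (C ^ (2 * Q)) ^ n * n ^ (L * (n + r) * (2 * Q))
        ≤⟨ *-monoˡ-≤ _ (^-monoˡ-≤ n (≤-trans (m≤n+m _ (suc (suc slack * S))) large)) ⟩
      n ^ n * n ^ (L * (n + r) * (2 * Q))           ≡⟨ sym (^-distribˡ-+-* n n _) ⟩
      n ^ (n + L * (n + r) * (2 * Q))               ≤⟨ ^-monoʳ-≤ n exponent≤ ⟩
      n ^ (P * n * (2 * L) + 2 * Q * (T * m))       ≡⟨ ^-distribˡ-+-* n (P * n * (2 * L)) _ ⟩
      n ^ (P * n * (2 * L)) * n ^ (2 * Q * (T * m)) ≡⟨ cong (_* n ^ (2 * Q * (T * m))) (sym (^-*-assoc n (P * n) (2 * L))) ⟩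
      (n ^ (P * n)) ^ (2 * L) * n ^ (2 * Q * (T * m)) ∎))
      where
      open ≤-Reasoning
      e₁ : ∀ Q L → Q * (2 * L) ≡ L * (2 * Q)
      e₁ = solve-∀
      e₂ : ∀ n s Q r → n + suc s * (n + r) * (2 * Q) ≡ 2 * (Q * s) * n + n + (2 * Q * n + 2 * suc s * Q * r)
      e₂ = solve-∀
      e₃ : ∀ Q s n z → 2 * (Q * s) * n + n + (n + z) ≡ 2 * suc (Q * s) * n + z
      e₃ = solve-∀
      e₄ : ∀ P L n → 2 * (P * L) * n ≡ P * n * (2 * L)
      e₄ = solve-∀
      exponent≤ : n + L * (n + r) * (2 * Q) ≤ P * n * (2 * L) + 2 * Q * (T * m)
      exponent≤ = begin
        n + L * (n + r) * (2 * Q) ≡⟨ e₂ n s Q r ⟩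
        2 * (Q * s) * n + n + (2 * Q * n + 2 * L * Q * r) ≤⟨ +-monoʳ-≤ (2 * (Q * s) * n + n) exponents ⟩
        2 * (Q * s) * n + n + (n + 2 * Q * (T * m)) ≡⟨ e₃ Q s n (2 * Q * (T * m)) ⟩
        2 * suc (Q * s) * n + 2 * Q * (T * m) ≤⟨ +-monoˡ-≤ _ (*-monoˡ-≤ n (*-monoʳ-≤ 2 rate)) ⟩
        2 * (P * L) * n + 2 * Q * (T * m) ≡⟨ cong (_+ 2 * Q * (T * m)) (e₄ P L n) ⟩
        P * n * (2 * L) + 2 * Q * (T * m) ∎

  eventually-bounded : ∀ P → Q * s < P * suc s → ∃[ N ] ∀ n → N ≤ n → ∀ F → PairwiseCreating n (suc s) F →
                       length F ^ Q ≤ n ^ (P * n)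
  eventually-bounded P rate = threshold , λ n large F pc → let open Large n large in
    conclusion P (length F) rate (growth (length F) (codes F pc))

-- The hypothesis on `c` and `b` says that `1 - c / b` is at least the rate `1 - 1 / suc s`, for
-- which `eventually-bounded` holds.
upperRate : ∀ s c b → 2 ≤ s → c * suc s ≤ b → UpperRate (suc s) (b ∸ c) b
upperRate s c b 2≤s c*L≤b p q 0<q rate = eventually-bounded s q 2≤s 0<q p (*-cancelʳ-< b _ _ (begin-strict
  q * s * b             ≡⟨ *-assoc q s b ⟩
  q * (s * b)           ≤⟨ *-monoʳ-≤ q s*b≤ ⟩
  q * ((b ∸ c) * suc s) ≡⟨ sym (*-assoc q (b ∸ c) (suc s)) ⟩
  q * (b ∸ c) * suc s   <⟨ *-monoˡ-< (suc s) rate ⟩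
  p * b * suc s         ≡⟨ shuffle p b (suc s) ⟩
  p * suc s * b         ∎))
  where
  open ≤-Reasoning
  shuffle : ∀ p b l → p * b * l ≡ p * l * b
  shuffle = solve-∀
  s*b≤ : s * b ≤ (b ∸ c) * suc s
  s*b≤ = begin
    s * b                   ≤⟨ m+n≤o⇒m≤o∸n (s * b) (begin
      s * b + c * suc s       ≤⟨ +-monoʳ-≤ (s * b) c*L≤b ⟩
      s * b + b               ≡⟨ trans (+-comm (s * b) b) (*-comm (suc s) b) ⟩
      b * suc s               ∎) ⟩
    b * suc s ∸ c * suc s   ≡⟨ sym (*-distribʳ-∸ (suc s) b c) ⟩
    (b ∸ c) * suc s         ∎

theorem1p5 : ∀ (k : ℕ) → 2 ≤ k →
    ((k ≡ 2 ⊎ k ≡ 3 ⊎ k ≡ 5) → UpperRate (2 * k) (k * k ∸ 1) (k * k)) ×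
    ((k ≢ 2 × k ≢ 3 × k ≢ 5) → k % 2 ≡ 0 →
    UpperRate (2 * k) (3 * k * k ∸ 2 * k ∸ 2) (3 * k * k ∸ 2 * k)) ×
    ((k ≢ 2 × k ≢ 3 × k ≢ 5) → k % 2 ≡ 1 →
    UpperRate (2 * k) (3 * k * k ∸ 3 * k ∸ 2) (3 * k * k ∸ 3 * k))
theorem1p5 k@(suc k-1) 2≤k =
  (λ _ → upperRate s 1 (k * k) 2≤s (≤-trans (≤-reflexive (*-identityˡ (2 * k))) (*-monoˡ-≤ k 2≤k))) ,
  -- Here `4k ≤ 3k² - 2k` is needed, that is `6k ≤ 3k²`, which is `2 ≤ k`.
  (λ _ _ → upperRate s 2 (3 * k * k ∸ 2 * k) 2≤s (m+n≤o⇒m≤o∸n (2 * (2 * k)) (begin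
    2 * (2 * k) + 2 * k ≡⟨ six k ⟩
    3 * k * 2           ≤⟨ *-monoʳ-≤ (3 * k) 2≤k ⟩
    3 * k * k           ∎))) ,
  -- Here `7k ≤ 3k²` is needed, which fails for `k = 2`; excluding that value gives `3 ≤ k` and even
  -- `9k ≤ 3k²`.
  (λ (k≢2 , _) _ → upperRate s 2 (3 * k * k ∸ 3 * k) 2≤s (m+n≤o⇒m≤o∸n (2 * (2 * k)) (begin
    2 * (2 * k) + 3 * k         ≤⟨ m≤m+n _ (2 * k) ⟩
    2 * (2 * k) + 3 * k + 2 * k ≡⟨ nine k ⟩
    3 * k * 3                   ≤⟨ *-monoʳ-≤ (3 * k) (≤∧≢⇒< 2≤k (≢-sym k≢2)) ⟩
    3 * k * k                   ∎)))
  where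
  open ≤-Reasoning
  -- Written so that `suc s` is `2 * k` by computation.
  s = k-1 + (k + 0)
  2≤s : 2 ≤ s
  2≤s = ≤-trans 2≤k (≤-trans (m≤m+n k 0) (m≤n+m (k + 0) k-1))
  six : ∀ k → 2 * (2 * k) + 2 * k ≡ 3 * k * 2
  six = solve-∀
  nine : ∀ k → 2 * (2 * k) + 3 * k + 2 * k ≡ 3 * k * 3
  nine = solve-∀
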